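{- Let $[\widehat{0},\widehat{1}]$ be a graded dual simplicial Eulerian poset of rank $n+1$. If the toric $h$-vector $(h_0,\ldots,h_n)$ of $(\widehat{0},\widehat{1}]^*$ satisfies $h_0\leq h_1\leq\cdots\leq h_{\lfloor n/2\rfloor}$, then $f([\widehat{0},\widehat{1}],x)$ has nonnegative coefficients.
   Context: A graded poset is a finite poset with a unique minimum $\widehat{0}$, a unique maximum $\widehat{1}$ and a rank function $\rho:P\to\mathbb{N}$ with $\rho(\widehat{0})=0$ and $\rho(y)=\rho(x)+1$ whenever $y$ covers $x$; its rank is $\rho(\widehat{1})$. It is Eulerian if $\sum_{z\in[u,v]}(-1)^{\rho(z)}=0$ for all $u<v$. It is dual simplicial if for every $t\neq\widehat{0}$ the interval $[t,\widehat{1}]$ is a Boolean algebra. $Q^*$ denotes the dual (order-reversed) poset of $Q$. Write $[\widehat{0},p)=\{q: q<p\}$ and $(\widehat{0},\widehat{1}]=[\widehat{0},\widehat{1}]\setminus\{\widehat{0}\}$. Stanley's toric polynomials: $f(\emptyset,x)=g(\emptyset,x)=1$ ($\emptyset$ being $[\widehat{0},\widehat{1})$ for the Eulerian poset of rank $0$), and for an Eulerian poset of rank at least $1$, $$f([\widehat{0},\widehat{1}),x)=\sum_{p\in[\widehat{0},\widehat{1})} g([\widehat{0},p),x)(x-1)^{\rho(\widehat{1})-1-\rho(p)},$$ $$g([\widehat{0},\widehat{1}),x)=\sum_{i=0}^{\lfloor(\rho(\widehat{1})-1)/2\rfloor}\left([x^i]f([\widehat{0},\widehat{1}),x)-[x^{i-1}]f([\widehat{0},\widehat{1}),x)\right)x^i.$$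 Closed interval version: a finite poset $P$ with unique minimum $\widehat{0}$ is lower Eulerian if every $[\widehat{0},p]$ is Eulerian, and then $f(P,x)=\sum_{p\in P}g([\widehat{0},p),x)(x-1)^{m-\rho(p)}$, where $m$ is the length of the longest chain in $P$. The polynomial $f([\widehat{0},\widehat{1}],x)$ is this polynomial for the lower Eulerian poset $P=[\widehat{0},\widehat{1}]$ (including its maximum element), for which $m=n+1$. Toric $h$-vector: for an Eulerian poset $Q$ of rank $n+1$, the toric $h$-vector $(h_0,\dots,h_n)$ of $Q\setminus\{\widehat{1}_Q\}$ is defined by $\sum_i h_ix^i=x^nf(Q\setminus\{\widehat{1}_Q\},1/x)$ (which, by a theorem of Stanley, equals $f(Q\setminus\{\widehat{1}_Q\},x)$). Here it is applied to $Q=[\widehat{0},\widehat{1}]^*$, whose maximum is $\widehat{0}$. -}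

module Defs where

open import Data.Fin.Base using (Fin)
open import Data.Fin.Induction using (spo-wellFounded; spo-noetherian)
open import Data.Fin.Properties using (any?)
open import Data.Fin.Subset using (Subset; _⊆_)
open import Data.Integer.Base as ℤ using (ℤ; 0ℤ; 1ℤ; -1ℤ)
open import Data.List.Base as List using (List; []; _∷_; allFin; applyUpTo; filter; foldr)
open import Data.List.Properties using (map-cong)
open import Data.Nat.Base as ℕ using (ℕ; zero; suc; pred; _∸_; ⌊_/2⌋)
import Data.Nat.Properties as ℕₚ
open import Data.Product.Base using (Σ; ∃-syntax; _×_; _,_; proj₁; proj₂)
open import Function.Base using (flip; _∘_; _on_)
open import Induction.WellFounded using (WellFounded; Acc; acc; WfRec; module All; module FixPoint)
open import Level using (0ℓ)
open import Relation.Binary.Construct.Flip.EqAndOrd as Flip using ()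
import Relation.Binary.Construct.NonStrictToStrict as ToStrict
open import Relation.Binary.Core using (Rel)
open import Relation.Binary.Definitions using (Decidable; Minimum; Maximum)
open import Relation.Binary.Morphism.Structures using (IsOrderIsomorphism)
open import Relation.Binary.PropositionalEquality
  using (_≡_; _≢_; refl; sym; trans; cong; subst)
open import Relation.Binary.Structures using (IsDecPartialOrder; IsStrictPartialOrder)
open import Relation.Nullary using (¬_; Dec; yes; no)
open import Relation.Nullary.Decidable using (_×-dec_)

-- Coefficient lists, constant term first. Lists differing by trailing
-- zeros denote the same polynomial; only `coeff` is ever observed.
Poly : Set
Poly = List ℤ

coeff : Poly → ℕ → ℤ
coeff []      _       = 0ℤ
coeff (a ∷ _) zero    = a
coeff (_ ∷ p) (suc i) = coeff p i

infixl 6 _⊕_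
infixl 7 _⊗_
infixr 8 _⊗^_

_⊕_ : Poly → Poly → Poly
[]      ⊕ q       = q
(a ∷ p) ⊕ []      = a ∷ p
(a ∷ p) ⊕ (b ∷ q) = a ℤ.+ b ∷ p ⊕ q

_⊗_ : Poly → Poly → Poly
[]      ⊗ q = []
(a ∷ p) ⊗ q = List.map (a ℤ.*_) q ⊕ (0ℤ ∷ p ⊗ q)

1ₚ : Poly
1ₚ = 1ℤ ∷ []

_⊗^_ : Poly → ℕ → Poly
p ⊗^ zero  = 1ₚ
p ⊗^ suc k = p ⊗ p ⊗^ k

x-1 : Poly
x-1 = -1ℤ ∷ 1ℤ ∷ []

∑ₚ : List Poly → Poly
∑ₚ = foldr _⊕_ []

∑ℤ : List ℤ → ℤ
∑ℤ = foldr ℤ._+_ 0ℤ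

when : {A : Set} → Dec A → (A → Poly) → Poly
when (yes a) p = p a
when (no  _) p = []

-- xⁿ p(1/x), for p of degree at most n.
reciprocal : ℕ → Poly → Poly
reciprocal n p = applyUpTo (λ i → coeff p (n ∸ i)) (suc n)

NonNegative : Poly → Set
NonNegative p = ∀ i → 0ℤ ℤ.≤ coeff p i

-- A finite poset is given on Fin size, i.e. with its elements labelled
-- in an arbitrary way, unrelated to the order of Fin.
record GradedPoset : Set₁ where
  infix 4 _⊑_
  field
    size              : ℕ
    _⊑_               : Rel (Fin size) 0ℓ
    isDecPartialOrder : IsDecPartialOrder _≡_ _⊑_
    0̂ 1̂               : Fin size
    0̂-minimum         : Minimum _⊑_ 0̂
    1̂-maximum         : Maximum _⊑_ 1̂

  open IsDecPartialOrder isDecPartialOrder public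
    using (isPartialOrder; _≟_) renaming (_≤?_ to _⊑?_)
  open ToStrict _≡_ _⊑_ public using () renaming (_<_ to _⊏_)

  infix 4 _⋖_
  _⋖_ : Rel (Fin size) 0ℓ
  x ⋖ y = x ⊏ y × (∀ z → ¬ (x ⊏ z × z ⊏ y))

  field
    ρ   : Fin size → ℕ
    ρ-0̂ : ρ 0̂ ≡ 0
    ρ-⋖ : ∀ {x y} → x ⋖ y → ρ y ≡ suc (ρ x)

  rank : ℕ
  rank = ρ 1̂

  _⊏?_ : Decidable _⊏_
  _⊏?_ = ToStrict.<-decidable _≡_ _⊑_ _≟_ _⊑?_

  ⊏-isStrictPartialOrder : IsStrictPartialOrder _≡_ _⊏_
  ⊏-isStrictPartialOrder = ToStrict.<-isStrictPartialOrder _≡_ _⊑_ isPartialOrder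

  ⊏-wellFounded : WellFounded _⊏_
  ⊏-wellFounded = spo-wellFounded ⊏-isStrictPartialOrder

  ρ-mono-⊏ : ∀ {x y} → x ⊏ y → ρ x ℕ.< ρ y
  ρ-mono-⊏ {x} {y} = go x y (⊏-wellFounded y) (spo-noetherian ⊏-isStrictPartialOrder x)
    where
    go : ∀ x y → Acc _⊏_ y → Acc (flip _⊏_) x → x ⊏ y → ρ x ℕ.< ρ y
    go x y (acc ry) (acc rx) x⊏y with any? (λ z → (x ⊏? z) ×-dec (z ⊏? y))
    ... | yes (z , x⊏z , z⊏y) =
          ℕₚ.<-trans (go x z (ry z⊏y) (acc rx) x⊏z) (go z y (acc ry) (rx x⊏z) z⊏y)
    ... | no ∄z = ℕₚ.≤-reflexive (sym (ρ-⋖ (x⊏y , λ z p → ∄z (z , p))))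

  ρ≤rank : ∀ x → ρ x ℕ.≤ rank
  ρ≤rank x with x ≟ 1̂
  ... | yes refl = ℕₚ.≤-refl
  ... | no  x≢1̂  = ℕₚ.<⇒≤ (ρ-mono-⊏ (1̂-maximum x , x≢1̂))

_* : GradedPoset → GradedPoset
P * = record
  { size              = size
  ; _⊑_               = flip _⊑_
  ; isDecPartialOrder = record
    { isPartialOrder = Flip.isPartialOrder isPartialOrder
    ; _≟_            = _≟_
    ; _≤?_           = flip _⊑?_
    }
  ; 0̂                 = 1̂
  ; 1̂                 = 0̂
  ; 0̂-minimum         = 1̂-maximum
  ; 1̂-maximum         = 0̂-minimum
  ; ρ                 = λ x → rank ∸ ρ x
  ; ρ-0̂               = ℕₚ.n∸n≡0 rank
  ; ρ-⋖               = λ {x} {y} ((y⊑x , x≢y) , noneBetween) →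
      let y⋖x = (y⊑x , x≢y ∘ sym)
              , λ z ((y⊑z , y≢z) , (z⊑x , z≢x)) →
                  noneBetween z ((z⊑x , z≢x ∘ sym) , (y⊑z , y≢z ∘ sym))
          ρx≡1+ρy = ρ-⋖ y⋖x
      in trans (cong (suc rank ∸_) (sym ρx≡1+ρy)) (ℕₚ.+-∸-assoc 1 (ρ≤rank x))
  }
  where open GradedPoset P

module _ (P : GradedPoset) where
  open GradedPoset P

  interval : (u v : Fin size) → List (Fin size)
  interval u v = filter (λ z → (u ⊑? z) ×-dec (z ⊑? v)) (allFin size)

  IsEulerian : Set
  IsEulerian = ∀ u v → u ⊏ v → ∑ℤ (List.map (λ z → -1ℤ ℤ.^ ρ z) (interval u v)) ≡ 0ℤ

  Interval : (u v : Fin size) → Set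
  Interval u v = Σ (Fin size) λ z → u ⊑ z × z ⊑ v

  -- The finite Boolean algebra of rank k is the poset of all subsets of
  -- a k-element set. Elements of an interval are compared through their
  -- first components, so that proofs of membership are ignored.
  IsBooleanInterval : (u v : Fin size) → Set
  IsBooleanInterval u v =
    ∃[ k ] Σ (Interval u v → Subset k) λ φ →
      IsOrderIsomorphism (_≡_ on proj₁) _≡_ (_⊑_ on proj₁) _⊆_ φ

  IsDualSimplicial : Set
  IsDualSimplicial = ∀ t → t ≢ 0̂ → IsBooleanInterval t 1̂

-- g([0̂,p),x) in terms of r = ρ(p) and f([0̂,p),x).
gFrom : (r : ℕ) → Poly → Poly
gFrom zero    f = 1ₚ
gFrom (suc r) f = applyUpTo difference (suc ⌊ r /2⌋)
  where
  difference : ℕ → ℤ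
  difference zero    = coeff f zero
  difference (suc i) = coeff f (suc i) ℤ.- coeff f i

module Toric (P : GradedPoset) where
  open GradedPoset P

  ∑⊏ : ∀ p → (∀ {q} → q ⊏ p → Poly) → Poly
  ∑⊏ p t = ∑ₚ (List.map (λ q → when (q ⊏? p) t) (allFin size))

  -- f([0̂,p),x) in terms of r = ρ(p) and the polynomials g([0̂,q),x) for
  -- q < p.
  fFrom : (r : ℕ) → ∀ p → WfRec _⊏_ (λ _ → Poly) p → Poly
  fFrom zero    p g = 1ₚ
  fFrom (suc r) p g = ∑⊏ p λ {q} q⊏p → g q⊏p ⊗ x-1 ⊗^ (r ∸ ρ q)

  gStep : ∀ p → WfRec _⊏_ (λ _ → Poly) p → Poly
  gStep p g = gFrom (ρ p) (fFrom (ρ p) p g)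

  -- The argument p of g[0̂,_⟩ and f[0̂,_⟩ stands for the half-open
  -- interval [0̂,p), whose closure [0̂,p] has rank ρ(p).
  g[0̂,_⟩ : Fin size → Poly
  g[0̂,_⟩ = All.wfRec ⊏-wellFounded 0ℓ (λ _ → Poly) gStep

  f[0̂,_⟩ : Fin size → Poly
  f[0̂, p ⟩ = fFrom (ρ p) p (λ {q} _ → g[0̂, q ⟩)

  g-unfold : ∀ p → g[0̂, p ⟩ ≡ gFrom (ρ p) f[0̂, p ⟩
  g-unfold p = FixPoint.unfold-wfRec ⊏-wellFounded (λ _ → Poly) gStep gStep-ext {p}
    where
    ∑⊏-ext : ∀ p {t t′ : ∀ {q} → q ⊏ p → Poly} →
             (∀ {q} (q⊏p : q ⊏ p) → t q⊏p ≡ t′ q⊏p) → ∑⊏ p t ≡ ∑⊏ p t′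
    ∑⊏-ext p {t} {t′} t≗t′ = cong ∑ₚ (map-cong pointwise (allFin size))
      where
      pointwise : ∀ q → when (q ⊏? p) t ≡ when (q ⊏? p) t′
      pointwise q with q ⊏? p
      ... | yes q⊏p = t≗t′ q⊏p
      ... | no  _   = refl

    fFrom-ext : ∀ r p {g g′ : WfRec _⊏_ (λ _ → Poly) p} →
                (∀ {q} (q⊏p : q ⊏ p) → g q⊏p ≡ g′ q⊏p) → fFrom r p g ≡ fFrom r p g′
    fFrom-ext zero    p g≗g′ = refl
    fFrom-ext (suc r) p g≗g′ =
      ∑⊏-ext p λ {q} q⊏p → cong (_⊗ x-1 ⊗^ (r ∸ ρ q)) (g≗g′ q⊏p)

    gStep-ext : ∀ p {g g′ : WfRec _⊏_ (λ _ → Poly) p} →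
                (∀ {q} (q⊏p : q ⊏ p) → g q⊏p ≡ g′ q⊏p) → gStep p g ≡ gStep p g′
    gStep-ext p g≗g′ = cong (gFrom (ρ p)) (fFrom-ext (ρ p) p g≗g′)

  -- f of [0̂,1̂] regarded as a lower Eulerian poset; the longest chain in
  -- [0̂,1̂] has length ρ(1̂).
  f[0̂,1̂] : Poly
  f[0̂,1̂] = ∑ₚ (List.map (λ p → g[0̂, p ⟩ ⊗ x-1 ⊗^ (rank ∸ ρ p)) (allFin size))

  -- The i-th entry of the toric h-vector of P ∖ {1̂}, where P has rank
  -- n + 1; it is indexed by 0 ≤ i ≤ n.
  toric-h : ℕ → ℤ
  toric-h i = coeff (reciprocal (pred rank) f[0̂, 1̂ ⟩) i

{-# OPTIONS --safe #-}
module Submission where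

-- For p ≠ 0̂ let h(p) = Σ_{0̂ < q ≤ p} (x - 1)^{ρ(q) - 1}, the h-polynomial of the simplicial poset
-- [0̂, p]*, and let b(p) be the truncation of (1 - x)h(p) to degrees below ρ(p)/2. Since the
-- intervals [q, p] with q ≠ 0̂ are Boolean, Σ_{q ≤ r ≤ p} y^{ρ(r) - ρ(q)} = (1 + y)^{ρ(p) - ρ(q)}.
-- Together with Σ_{0̂ < q ≤ p} (-1)^{ρ(q)} = -1, this yields the palindromicity of h(p) and then
-- Σ_{q ≤ p} a(q) (x - 1)^{ρ(p) - ρ(q)} = x^{ρ(p)} a(p)(1/x) for
-- a(p) = Σ_{0̂ < r ≤ p} (-1)^{ρ(r) - 1} b(r), a(0̂) = 1. This reciprocity and deg a(p) < ρ(p)/2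
-- characterise g([0̂, p), x), so f([0̂, 1̂], x) = x^{n+1} a(1̂)(1/x). Counting the elements above
-- each q turns the coefficient of x^j in a(1̂) into
--   Σ_{i ≤ n} C(i, j) C(n - i, j) (h_i - h_{i-1}),
-- and as (h_i) is palindromic, this is a combination of the differences h_i - h_{i-1} with
-- i ≤ n/2, with nonnegative coefficients because C(i, j) C(n - i, j) increases up to the middle.

open import Defs
import Algebra.Properties.Semiring.Sum
open import Data.Bool.Base using (if_then_else_)
open import Data.Fin.Base using (Fin; zero; suc)
import Data.Fin.Properties as Finₚ
open import Data.Fin.Subset using (Subset; inside; outside; _⊆_; ∣_∣; ⊥)
open import Data.Fin.Subset.Properties using (_⊆?_; ⊆-antisym; ⊆-min; out⊆; s⊆s; drop-∷-⊆)
open import Data.Integer.Base as ℤ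
  using (ℤ; 0ℤ; 1ℤ; -1ℤ; _+_; _*_; _-_; -_; _≤_; _^_)
  renaming (+_ to pos)
import Data.Integer.Properties as ℤₚ
open import Data.Integer.Tactic.RingSolver using (solve-∀)
open import Data.List.Base as List using ([]; _∷_)
open import Data.Nat.Base as ℕ using (ℕ; zero; suc; ⌊_/2⌋; _∸_) renaming (_<_ to _<ℕ_)
open import Data.Nat.Combinatorics using (_C_; nCk+nC[k+1]≡[n+1]C[k+1]; k>n⇒nCk≡0)
open import Data.Nat.GeneralisedArithmetic using (fold; fold-+)
import Data.Nat.Properties as ℕₚ
import Data.Nat.Tactic.RingSolver as ℕ-Solver
open import Data.Product.Base using (_×_; _,_; proj₁; proj₂)
open import Data.Sum.Base as Sum using (_⊎_; inj₁; inj₂)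
open import Data.Unit.Base using (⊤; tt)
open import Data.Vec.Base using ([]; _∷_; here)
open import Data.Vec.Properties using (∷-injectiveʳ)
open import Function.Base using (_∘_; case_of_; flip; id)
open import Induction.WellFounded using (Acc; acc)
open import Relation.Binary.Definitions using (tri<; tri≈; tri>)
open import Relation.Binary.Morphism.Structures using (IsOrderIsomorphism)
open import Relation.Binary.PropositionalEquality
  using (_≡_; _≢_; _≗_; refl; sym; trans; cong; cong₂; subst; subst₂; module ≡-Reasoning)
open import Relation.Binary.Structures using (IsPartialOrder)
open import Relation.Nullary using (¬_; Dec; does; yes; no; contradiction)
open import Relation.Nullary.Decidable using (_×-dec_; ¬?)

open Algebra.Properties.Semiring.Sum ℤₚ.+-*-semiring
  using (sum; sum-cong-≗; sum-replicate-zero; ∑-distrib-+; ∑-comm; *-distribˡ-sum)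

-- Binomial coefficients

-- The recursion for g truncates at every step, so a closed formula is checked instead of unrolled.
-- The obstacle is that [0̂, p] itself need not be Boolean: in the reciprocity the term q = 0̂
-- contributes (x - 1)^{ρ(p)} outside every cube, and the formula is built to cancel it. Put D(r) =
-- (x - 1)h(r), antipalindromic in degree ρ(r). Its lower half differs from the reversal of that
-- half by exactly D(r), so no truncation is left in the error terms; with the signs (-1)^{ρ(r)} the
-- errors x^{ρ(p) - ρ(r)} D(r) add up to -(x - 1)^{ρ(p)}. The given h-vector enters through the
-- dual: below its maximum the lower intervals of the dual are Boolean and have g = 1, so that f of
-- the dual without its maximum is h(1̂). D replaces h in the computations: its coefficients are the
-- differences h_{i-1} - h_i, and its antisymmetry encodes the palindromicity of h. Polynomials
-- become coefficient sequences on which x and x - 1 act as linear operators.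

predBinom : ℕ → ℕ → ℕ
-- The value at zero matters: `pred n C j` would give 1 at n = j = 0, whereas the cube of dimension
-- 0 contributes nothing in `Cube-signedTail`.
predBinom zero    j = 0
predBinom (suc n) j = n C j

-- Absorption, (j + 1) C(n, j + 1) = (n - j) C(n, j), arranged so that no truncated subtraction
-- occurs.
binom-absorb : ∀ n j → suc j ℕ.* (n C suc j) ℕ.+ j ℕ.* (n C j) ≡ n ℕ.* (n C j)
binom-absorb zero    zero    = refl
binom-absorb zero    (suc j)
  rewrite k>n⇒nCk≡0 {zero} {suc j} (ℕ.s≤s ℕ.z≤n) | k>n⇒nCk≡0 {zero} {suc (suc j)} (ℕ.s≤s ℕ.z≤n)
  = cong₂ ℕ._+_ (ℕₚ.*-zeroʳ j) (ℕₚ.*-zeroʳ j)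
binom-absorb (suc n) zero
  rewrite sym (nCk+nC[k+1]≡[n+1]C[k+1] n zero)
  = trans (regroup (n C 1)) (cong suc (binom-absorb n zero))
  where
  regroup : ∀ x → 1 ℕ.* (1 ℕ.+ x) ℕ.+ 0 ≡ 1 ℕ.+ (1 ℕ.* x ℕ.+ 0)
  regroup = ℕ-Solver.solve-∀
binom-absorb (suc n) (suc j)
  rewrite sym (nCk+nC[k+1]≡[n+1]C[k+1] n (suc j)) | sym (nCk+nC[k+1]≡[n+1]C[k+1] n j)
  = trans (regroup₁ j (n C j) (n C suc j) (n C suc (suc j)))
   (trans (cong₂ (λ p q → p ℕ.+ q ℕ.+ (n C j ℕ.+ n C suc j)) (binom-absorb n (suc j)) (binom-absorb n j))
          (regroup₂ n (n C j) (n C suc j)))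
  where
  regroup₁ : ∀ j a b d →
    suc (suc j) ℕ.* (b ℕ.+ d) ℕ.+ suc j ℕ.* (a ℕ.+ b) ≡
    (suc (suc j) ℕ.* d ℕ.+ suc j ℕ.* b) ℕ.+ (suc j ℕ.* b ℕ.+ j ℕ.* a) ℕ.+ (a ℕ.+ b)
  regroup₁ = ℕ-Solver.solve-∀
  regroup₂ : ∀ n a b → n ℕ.* b ℕ.+ n ℕ.* a ℕ.+ (a ℕ.+ b) ≡ suc n ℕ.* (a ℕ.+ b)
  regroup₂ = ℕ-Solver.solve-∀

module _ where
  open ℕₚ.≤-Reasoning

  -- The ratio C(i, j + 1) / C(i, j) = (i - j) / (j + 1) grows with i. Division is avoided by
  -- multiplying both sides by j + 1 and adding j C(i, j) C(k, j); absorption then reduces the claim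
  -- to i ≤ k.
  binom-logConcave : ∀ {i k} j → i ℕ.≤ k → (i C suc j) ℕ.* (k C j) ℕ.≤ (i C j) ℕ.* (k C suc j)
  binom-logConcave {i} {k} j i≤k = ℕₚ.*-cancelˡ-≤ (suc j) (ℕₚ.+-cancelʳ-≤ (j ℕ.* ((i C j) ℕ.* (k C j))) _ _ (begin
    suc j ℕ.* ((i C suc j) ℕ.* (k C j)) ℕ.+ j ℕ.* ((i C j) ℕ.* (k C j))
      ≡⟨ regroup₁ j (i C suc j) (i C j) (k C j) ⟩
    (suc j ℕ.* (i C suc j) ℕ.+ j ℕ.* (i C j)) ℕ.* (k C j)
      ≡⟨ cong (λ t → t ℕ.* (k C j)) (binom-absorb i j) ⟩
    i ℕ.* (i C j) ℕ.* (k C j)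
      ≤⟨ ℕₚ.*-monoˡ-≤ (k C j) (ℕₚ.*-monoˡ-≤ (i C j) i≤k) ⟩
    k ℕ.* (i C j) ℕ.* (k C j)
      ≡⟨ regroup₂ k (i C j) (k C j) ⟩
    (k ℕ.* (k C j)) ℕ.* (i C j)
      ≡⟨ cong (λ t → t ℕ.* (i C j)) (binom-absorb k j) ⟨
    (suc j ℕ.* (k C suc j) ℕ.+ j ℕ.* (k C j)) ℕ.* (i C j)
      ≡⟨ regroup₃ j (k C suc j) (k C j) (i C j) ⟩
    suc j ℕ.* ((i C j) ℕ.* (k C suc j)) ℕ.+ j ℕ.* ((i C j) ℕ.* (k C j)) ∎))
    where
    regroup₁ : ∀ j a b d → suc j ℕ.* (a ℕ.* d) ℕ.+ j ℕ.* (b ℕ.* d) ≡ (suc j ℕ.* a ℕ.+ j ℕ.* b) ℕ.* d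
    regroup₁ = ℕ-Solver.solve-∀
    regroup₂ : ∀ k b d → k ℕ.* b ℕ.* d ≡ k ℕ.* d ℕ.* b
    regroup₂ = ℕ-Solver.solve-∀
    regroup₃ : ∀ j a b d → (suc j ℕ.* a ℕ.+ j ℕ.* b) ℕ.* d ≡ suc j ℕ.* (d ℕ.* a) ℕ.+ j ℕ.* (d ℕ.* b)
    regroup₃ = ℕ-Solver.solve-∀

  -- Pascal's rule produces the same product on both sides, and log-concavity compares the rest. For
  -- i + k = n + 1 and i ≥ 1 this compares the values of C(i, j) C(n - i, j) at i - 1 and at i.
  binom-predBinom-mono : ∀ {i k} j → i ℕ.≤ k → (k C j) ℕ.* predBinom i j ℕ.≤ (i C j) ℕ.* predBinom k j
  binom-predBinom-mono {k = k} j ℕ.z≤n = ℕₚ.≤-trans (ℕₚ.≤-reflexive (ℕₚ.*-zeroʳ (k C j))) ℕ.z≤n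
  binom-predBinom-mono zero (ℕ.s≤s i≤k) = ℕₚ.≤-refl
  binom-predBinom-mono {suc i} {suc k} (suc j) (ℕ.s≤s i≤k)
    rewrite sym (nCk+nC[k+1]≡[n+1]C[k+1] k j) | sym (nCk+nC[k+1]≡[n+1]C[k+1] i j) = begin
    ((k C j) ℕ.+ (k C suc j)) ℕ.* (i C suc j)
      ≡⟨ regroup (k C j) (k C suc j) (i C suc j) ⟩
    (i C suc j) ℕ.* (k C j) ℕ.+ (i C suc j) ℕ.* (k C suc j)
      ≤⟨ ℕₚ.+-monoˡ-≤ ((i C suc j) ℕ.* (k C suc j)) (binom-logConcave j i≤k) ⟩
    (i C j) ℕ.* (k C suc j) ℕ.+ (i C suc j) ℕ.* (k C suc j)
      ≡⟨ ℕₚ.*-distribʳ-+ (k C suc j) (i C j) (i C suc j) ⟨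
    ((i C j) ℕ.+ (i C suc j)) ℕ.* (k C suc j) ∎
    where
    regroup : ∀ a b d → (a ℕ.+ b) ℕ.* d ≡ d ℕ.* a ℕ.+ d ℕ.* b
    regroup = ℕ-Solver.solve-∀

open ≡-Reasoning

-- Power series as coefficient sequences

Series : Set
Series = ℕ → ℤ

one : Series
one zero    = 1ℤ
one (suc _) = 0ℤ

infixr 8 x·_ δ_

x·_ : Series → Series
(x· u) zero    = 0ℤ
(x· u) (suc i) = u i

-- Multiplication by x - 1, so that `c k` below is (x - 1)^k.
δ_ : Series → Series
(δ u) i = (x· u) i - u i

infixr 8 x^_·_ δ^_·_

x^_·_ δ^_·_ : ℕ → Series → Series
x^ k · u = fold u x·_ k
δ^ k · u = fold u δ_ k

-- Compatibility with `≗` is a field because pointwise equal sequences need not be propositionally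
-- equal.
record Linear (L : Series → Series) : Set where
  field
    ≗-cong : ∀ {u v} → u ≗ v → L u ≗ L v
    +-homo : ∀ u v → L (λ i → u i + v i) ≗ λ i → L u i + L v i
    *-homo : ∀ c u → L (λ i → c * u i) ≗ λ i → c * L u i

  0-homo : L (λ _ → 0ℤ) ≗ λ _ → 0ℤ
  0-homo = *-homo 0ℤ (λ _ → 0ℤ)

  sum-homo : ∀ {n} (u : Fin n → Series) → L (λ i → sum λ r → u r i) ≗ λ i → sum λ r → L (u r) i
  sum-homo {zero}  u i = 0-homo i
  sum-homo {suc n} u i = trans
    (+-homo (u zero) (λ i → sum λ r → u (suc r) i) i)
    (cong (L (u zero) i +_) (sum-homo (u ∘ suc) i))

open Linear

x·-linear : Linear x·_
x·-linear .≗-cong u≗v zero    = refl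
x·-linear .≗-cong u≗v (suc i) = u≗v i
x·-linear .+-homo u v zero    = refl
x·-linear .+-homo u v (suc i) = refl
x·-linear .*-homo c u zero    = sym (ℤₚ.*-zeroʳ c)
x·-linear .*-homo c u (suc i) = refl

δ-linear : Linear δ_
δ-linear .≗-cong u≗v i = cong₂ _-_ (x·-linear .≗-cong u≗v i) (u≗v i)
δ-linear .+-homo u v i = trans (cong (_- (u i + v i)) (x·-linear .+-homo u v i)) (regroup ((x· u) i) ((x· v) i) (u i) (v i))
  where
  regroup : ∀ a b c d → (a + b) - (c + d) ≡ (a - c) + (b - d)
  regroup = solve-∀
δ-linear .*-homo c u i = trans (cong (_- c * u i) (x·-linear .*-homo c u i)) (factor c ((x· u) i) (u i))
  where
  factor : ∀ c a b → c * a - c * b ≡ c * (a - b)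
  factor = solve-∀

fold-linear : ∀ {L} → Linear L → ∀ k → Linear (λ u → fold u L k)
fold-linear lin zero .≗-cong u≗v = u≗v
fold-linear lin zero .+-homo u v i = refl
fold-linear lin zero .*-homo c u i = refl
fold-linear lin (suc k) .≗-cong u≗v = lin .≗-cong (fold-linear lin k .≗-cong u≗v)
fold-linear lin (suc k) .+-homo u v i =
  trans (lin .≗-cong (fold-linear lin k .+-homo u v) i) (lin .+-homo _ _ i)
fold-linear lin (suc k) .*-homo c u i =
  trans (lin .≗-cong (fold-linear lin k .*-homo c u) i) (lin .*-homo c _ i)

fold-step : ∀ {A : Set} (f : A → A) x k → fold (f x) f k ≡ fold x f (suc k)
fold-step f x zero    = refl
fold-step f x (suc k) = cong f (fold-step f x k)

Degree≤ : ℕ → Series → Set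
Degree≤ N u = ∀ i → N <ℕ i → u i ≡ 0ℤ

δ-degree : ∀ {N u} → Degree≤ N u → Degree≤ (suc N) (δ u)
δ-degree deg (suc i) (ℕ.s≤s N<i) = cong₂ _-_ (deg i N<i) (deg (suc i) (ℕₚ.m<n⇒m<1+n N<i))

c : ℕ → Series
c k = δ^ k · one

c-degree : ∀ k → Degree≤ k (c k)
c-degree zero    (suc i) _ = refl
c-degree (suc k) = δ-degree (c-degree k)

-- Reversal: rev N u is xᴺ u(1/x) with negative powers of x dropped.

rev : ℕ → Series → Series
rev zero    u zero    = u zero
rev zero    u (suc i) = 0ℤ
rev (suc N) u zero    = u (suc N)
rev (suc N) u (suc i) = rev N u i

rev-linear : ∀ N → Linear (rev N)
rev-linear zero    .≗-cong u≗v zero    = u≗v zero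
rev-linear zero    .≗-cong u≗v (suc i) = refl
rev-linear (suc N) .≗-cong u≗v zero    = u≗v (suc N)
rev-linear (suc N) .≗-cong u≗v (suc i) = rev-linear N .≗-cong u≗v i
rev-linear zero    .+-homo u v zero    = refl
rev-linear zero    .+-homo u v (suc i) = refl
rev-linear (suc N) .+-homo u v zero    = refl
rev-linear (suc N) .+-homo u v (suc i) = rev-linear N .+-homo u v i
rev-linear zero    .*-homo c u zero    = refl
rev-linear zero    .*-homo c u (suc i) = sym (ℤₚ.*-zeroʳ c)
rev-linear (suc N) .*-homo c u zero    = refl
rev-linear (suc N) .*-homo c u (suc i) = rev-linear N .*-homo c u i

rev-≤ : ∀ {N} u {i} → i ℕ.≤ N → rev N u i ≡ u (N ∸ i)
rev-≤ {zero}  u ℕ.z≤n       = refl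
rev-≤ {suc N} u ℕ.z≤n       = refl
rev-≤ {suc N} u (ℕ.s≤s i≤N) = rev-≤ u i≤N

rev-> : ∀ {N} u → Degree≤ N (rev N u)
rev-> {zero}  u (suc i) _           = refl
rev-> {suc N} u (suc i) (ℕ.s≤s N<i) = rev-> u i N<i

rev-suc : ∀ {N u} → Degree≤ N u → rev (suc N) u ≗ x· rev N u
rev-suc deg zero    = deg _ ℕₚ.≤-refl
rev-suc deg (suc i) = refl

rev-+ : ∀ m {N u} → Degree≤ N u → rev (m ℕ.+ N) u ≗ x^ m · rev N u
rev-+ zero    deg i = refl
rev-+ (suc m) {N} deg i = trans
  (rev-suc (λ k lt → deg k (ℕₚ.≤-<-trans (ℕₚ.m≤n+m N m) lt)) i)
  (x·-linear .≗-cong (rev-+ m deg) i)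

rev-x· : ∀ N u → rev (suc N) (x· u) ≗ rev N u
rev-x· zero    u zero    = refl
rev-x· zero    u (suc zero)    = refl
rev-x· zero    u (suc (suc i)) = refl
rev-x· (suc N) u zero    = refl
rev-x· (suc N) u (suc i) = rev-x· N u i

rev-nonneg : ∀ N {u} → (∀ i → 0ℤ ≤ u i) → ∀ i → 0ℤ ≤ rev N u i
rev-nonneg zero    0≤u zero    = 0≤u zero
rev-nonneg zero    0≤u (suc i) = ℤₚ.≤-refl
rev-nonneg (suc N) 0≤u zero    = 0≤u (suc N)
rev-nonneg (suc N) 0≤u (suc i) = rev-nonneg N 0≤u i

neg-linear : ∀ {L} → Linear L → ∀ u → L (λ i → - u i) ≗ λ i → - L u i
neg-linear {L} lin u i = begin
  L (λ i → - u i) i      ≡⟨ lin .≗-cong (λ i → sym (ℤₚ.-1*i≡-i (u i))) i ⟩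
  L (λ i → -1ℤ * u i) i  ≡⟨ lin .*-homo -1ℤ u i ⟩
  -1ℤ * L u i            ≡⟨ ℤₚ.-1*i≡-i (L u i) ⟩
  - L u i                ∎

-- x^{N+1} (1/x - 1) u(1/x) = (1 - x) x^N u(1/x).
rev-δ : ∀ {N u} → Degree≤ N u → rev (suc N) (δ u) ≗ λ i → - (δ rev N u) i
rev-δ {N} {u} deg i = begin
  rev (suc N) (δ u) i                                    ≡⟨ rev-linear (suc N) .+-homo (x· u) (λ i → - u i) i ⟩
  rev (suc N) (x· u) i + rev (suc N) (λ i → - u i) i     ≡⟨ cong₂ _+_ (rev-x· N u i) (neg-linear (rev-linear (suc N)) u i) ⟩
  rev N u i - rev (suc N) u i                            ≡⟨ cong (λ t → rev N u i - t) (rev-suc deg i) ⟩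
  rev N u i - (x· rev N u) i                             ≡⟨ swap (rev N u i) _ ⟩
  - (δ rev N u) i                                        ∎
  where
  swap : ∀ a b → a - b ≡ - (b - a)
  swap = solve-∀

sgn : ℕ → ℤ
sgn k = -1ℤ ^ k

rev-c : ∀ k → rev k (c k) ≗ λ i → sgn k * c k i
rev-c zero    zero    = refl
rev-c zero    (suc i) = refl
rev-c (suc k) i = begin
  rev (suc k) (δ c k) i          ≡⟨ rev-δ (c-degree k) i ⟩
  - (δ rev k (c k)) i            ≡⟨ cong -_ (δ-linear .≗-cong (rev-c k) i) ⟩
  - (δ (λ i → sgn k * c k i)) i  ≡⟨ cong -_ (δ-linear .*-homo (sgn k) (c k) i) ⟩
  - (sgn k * (δ c k) i)          ≡⟨ negate (sgn k) _ ⟩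
  -1ℤ * sgn k * (δ c k) i        ∎
  where
  negate : ∀ a b → - (a * b) ≡ -1ℤ * a * b
  negate = solve-∀

-- Sums over a Boolean algebra graded by cardinality

-- Cube M F is the sum of F |S| over the subsets S of an M-element set.
Cube : ℕ → (ℕ → ℤ) → ℤ
Cube zero    F = F zero
Cube (suc M) F = Cube M F + Cube M (F ∘ suc)

Cube-cong : ∀ M {F G} → (∀ s → s ℕ.≤ M → F s ≡ G s) → Cube M F ≡ Cube M G
Cube-cong zero    F≗G = F≗G zero ℕ.z≤n
Cube-cong (suc M) F≗G = cong₂ _+_
  (Cube-cong M (λ s s≤M → F≗G s (ℕₚ.m≤n⇒m≤1+n s≤M)))
  (Cube-cong M (λ s s≤M → F≗G (suc s) (ℕ.s≤s s≤M)))

Cube-+ : ∀ M F G → Cube M (λ s → F s + G s) ≡ Cube M F + Cube M G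
Cube-+ zero    F G = refl
Cube-+ (suc M) F G = trans
  (cong₂ _+_ (Cube-+ M F G) (Cube-+ M (F ∘ suc) (G ∘ suc)))
  (interchange (Cube M F) (Cube M G) (Cube M (F ∘ suc)) (Cube M (G ∘ suc)))
  where
  interchange : ∀ a b c d → (a + b) + (c + d) ≡ (a + c) + (b + d)
  interchange = solve-∀

Cube-* : ∀ M a F → Cube M (λ s → a * F s) ≡ a * Cube M F
Cube-* zero    a F = refl
Cube-* (suc M) a F = trans (cong₂ _+_ (Cube-* M a F) (Cube-* M a (F ∘ suc))) (sym (ℤₚ.*-distribˡ-+ a _ _))

-- The binomial theorem for the operators L and ε = K - L.
Cube-binomial : ∀ {L K} → Linear K → (ε : ℤ) → (∀ u i → L u i + ε * u i ≡ K u i) →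
  ∀ M u i → Cube M (λ s → ε ^ s * fold u L (M ∸ s) i) ≡ fold u K M i
Cube-binomial linK ε K≗L+ε zero    u i = ℤₚ.*-identityˡ (u i)
Cube-binomial {L} {K} linK ε K≗L+ε (suc M) u i = begin
  Cube M (λ s → ε ^ s * fold u L (suc M ∸ s) i) + Cube M (λ s → ε * ε ^ s * fold u L (M ∸ s) i)
    ≡⟨ cong₂ _+_
         (Cube-cong M λ s s≤M → cong (λ v → ε ^ s * v i) (trans (cong (fold u L) (ℕₚ.+-∸-assoc 1 s≤M)) (sym (fold-step L u (M ∸ s)))))
         (trans (Cube-cong M λ s _ → ℤₚ.*-assoc ε (ε ^ s) _) (Cube-* M ε _)) ⟩
  Cube M (λ s → ε ^ s * fold (L u) L (M ∸ s) i) + ε * Cube M (λ s → ε ^ s * fold u L (M ∸ s) i)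
    ≡⟨ cong₂ (λ a b → a + ε * b) (Cube-binomial linK ε K≗L+ε M (L u) i) (Cube-binomial linK ε K≗L+ε M u i) ⟩
  fold (L u) K M i + ε * fold u K M i
    ≡⟨ cong (fold (L u) K M i +_) (K^ .*-homo ε u i) ⟨
  fold (L u) K M i + fold (λ i → ε * u i) K M i
    ≡⟨ K^ .+-homo (L u) (λ i → ε * u i) i ⟨
  fold (λ i → L u i + ε * u i) K M i
    ≡⟨ K^ .≗-cong (K≗L+ε u) i ⟩
  fold (K u) K M i
    ≡⟨ cong (λ v → v i) (fold-step K u M) ⟩
  fold u K (suc M) i ∎
  where
  K^ = fold-linear linK M

-- The sum of (x - 1)^{|S|} is (1 + (x - 1))^M. Since the exponent rises with |S| here, the
-- induction replaces u by (x - 1)u in the second half of the cube.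
Cube-δ : ∀ M u i → Cube M (λ s → (δ^ s · u) i) ≡ (x^ M · u) i
Cube-δ zero    u i = refl
Cube-δ (suc M) u i = begin
  Cube M (λ s → (δ^ s · u) i) + Cube M (λ s → (δ^ suc s · u) i)
    ≡⟨ cong (Cube M (λ s → (δ^ s · u) i) +_) (Cube-cong M λ s _ → cong (λ v → v i) (sym (fold-step δ_ u s))) ⟩
  Cube M (λ s → (δ^ s · u) i) + Cube M (λ s → (δ^ s · δ u) i)
    ≡⟨ cong₂ _+_ (Cube-δ M u i) (Cube-δ M (δ u) i) ⟩
  (x^ M · u) i + (x^ M · δ u) i
    ≡⟨ x^M .+-homo u (δ u) i ⟨
  (x^ M · (λ i → u i + (δ u) i)) i
    ≡⟨ x^M .≗-cong (λ i → cancel (u i) ((x· u) i)) i ⟩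
  (x^ M · x· u) i
    ≡⟨ cong (λ v → v i) (fold-step x·_ u M) ⟩
  (x^ suc M · u) i ∎
  where
  x^M = fold-linear x·-linear M
  cancel : ∀ a b → a + (b - a) ≡ b
  cancel = solve-∀

Cube-δ-∸ : ∀ M u i → Cube M (λ s → (δ^ (M ∸ s) · u) i) ≡ (x^ M · u) i
Cube-δ-∸ M u i = trans
  (Cube-cong M λ s _ → trans (sym (ℤₚ.*-identityˡ _)) (cong (λ e → e * (δ^ (M ∸ s) · u) i) (sym (ℤₚ.^-zeroˡ s))))
  (Cube-binomial {δ_} x·-linear 1ℤ (λ u i → cancel (u i) ((x· u) i)) M u i)
  where
  cancel : ∀ a b → (b - a) + 1ℤ * a ≡ b
  cancel = solve-∀

Cube-x-∸ : ∀ M u i → Cube M (λ s → sgn s * (x^ (M ∸ s) · u) i) ≡ (δ^ M · u) i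
Cube-x-∸ = Cube-binomial δ-linear -1ℤ (λ u i → cong ((x· u) i +_) (ℤₚ.-1*i≡-i (u i)))

-- Sums over i + k = N

Antidiagonal : ℕ → (ℕ → ℕ → ℤ) → ℤ
Antidiagonal zero    f = f zero zero
Antidiagonal (suc N) f = f zero (suc N) + Antidiagonal N (f ∘ suc)

antidiagonal-cong : ∀ N {f g} → (∀ i k → i ℕ.+ k ≡ N → f i k ≡ g i k) → Antidiagonal N f ≡ Antidiagonal N g
antidiagonal-cong zero    f≗g = f≗g zero zero refl
antidiagonal-cong (suc N) f≗g = cong₂ _+_ (f≗g zero (suc N) refl)
  (antidiagonal-cong N λ i k i+k≡N → f≗g (suc i) k (cong suc i+k≡N))

antidiagonal-+ : ∀ N f g → Antidiagonal N (λ i k → f i k + g i k) ≡ Antidiagonal N f + Antidiagonal N g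
antidiagonal-+ zero    f g = refl
antidiagonal-+ (suc N) f g = trans
  (cong (f zero (suc N) + g zero (suc N) +_) (antidiagonal-+ N (f ∘ suc) (g ∘ suc)))
  (interchange (f zero (suc N)) (g zero (suc N)) (Antidiagonal N (f ∘ suc)) (Antidiagonal N (g ∘ suc)))
  where
  interchange : ∀ a b c d → (a + b) + (c + d) ≡ (a + c) + (b + d)
  interchange = solve-∀

antidiagonal-* : ∀ N a f → Antidiagonal N (λ i k → a * f i k) ≡ a * Antidiagonal N f
antidiagonal-* zero    a f = refl
antidiagonal-* (suc N) a f = trans
  (cong (a * f zero (suc N) +_) (antidiagonal-* N a (f ∘ suc)))
  (sym (ℤₚ.*-distribˡ-+ a (f zero (suc N)) (Antidiagonal N (f ∘ suc))))

antidiagonal-last : ∀ N f → Antidiagonal (suc N) f ≡ Antidiagonal N (λ i k → f i (suc k)) + f (suc N) zero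
antidiagonal-last zero    f = refl
antidiagonal-last (suc N) f = trans
  (cong (f zero (suc (suc N)) +_) (antidiagonal-last N (f ∘ suc)))
  (sym (ℤₚ.+-assoc (f zero (suc (suc N))) _ _))

antidiagonal-flip : ∀ N f → Antidiagonal N (flip f) ≡ Antidiagonal N f
antidiagonal-flip zero    f = refl
antidiagonal-flip (suc N) f = begin
  f (suc N) zero + Antidiagonal N (flip f ∘ suc)           ≡⟨ cong (f (suc N) zero +_) (antidiagonal-flip N (λ i k → f i (suc k))) ⟩
  f (suc N) zero + Antidiagonal N (λ i k → f i (suc k))    ≡⟨ ℤₚ.+-comm (f (suc N) zero) _ ⟩
  Antidiagonal N (λ i k → f i (suc k)) + f (suc N) zero    ≡⟨ antidiagonal-last N f ⟨
  Antidiagonal (suc N) f                                   ∎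

antidiagonal-nonneg : ∀ N {f} → (∀ i k → i ℕ.+ k ≡ N → 0ℤ ≤ f i k) → 0ℤ ≤ Antidiagonal N f
antidiagonal-nonneg zero    0≤f = 0≤f zero zero refl
antidiagonal-nonneg (suc N) 0≤f = ℤₚ.+-mono-≤ (0≤f zero (suc N) refl)
  (antidiagonal-nonneg N λ i k i+k≡N → 0≤f (suc i) k (cong suc i+k≡N))

antidiagonal-0 : ∀ N → Antidiagonal N (λ _ _ → 0ℤ) ≡ 0ℤ
antidiagonal-0 N = antidiagonal-* N 0ℤ (λ _ _ → 0ℤ)

antidiagonal-one : ∀ N (f : ℕ → ℕ → ℤ) → Antidiagonal N (λ i k → one i * f i k) ≡ f zero N
antidiagonal-one zero    f = ℤₚ.*-identityˡ (f zero zero)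
antidiagonal-one (suc N) f = trans
  (cong₂ _+_ (ℤₚ.*-identityˡ (f zero (suc N))) (antidiagonal-0 N))
  (ℤₚ.+-identityʳ (f zero (suc N)))

-- Summation by parts. Both boundary terms vanish: x u has no constant term, and u has degree at
-- most N.
antidiagonal-δ : ∀ {N u} → Degree≤ N u → (f : ℕ → ℕ → ℤ) →
  Antidiagonal (suc N) (λ i k → (δ u) i * f i k) ≡ Antidiagonal N (λ i k → u i * (f (suc i) k - f i (suc k)))
antidiagonal-δ {N} {u} deg f = begin
  Antidiagonal (suc N) (λ i k → (δ u) i * f i k)
    ≡⟨ antidiagonal-cong (suc N) (λ i k _ → expand ((x· u) i) (u i) (f i k)) ⟩
  Antidiagonal (suc N) (λ i k → (x· u) i * f i k + -1ℤ * (u i * f i k))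
    ≡⟨ antidiagonal-+ (suc N) (λ i k → (x· u) i * f i k) (λ i k → -1ℤ * (u i * f i k)) ⟩
  Antidiagonal (suc N) (λ i k → (x· u) i * f i k) + Antidiagonal (suc N) (λ i k → -1ℤ * (u i * f i k))
    ≡⟨ cong₂ _+_
         (ℤₚ.+-identityˡ X)
         (trans (antidiagonal-last N (λ i k → -1ℤ * (u i * f i k)))
           (trans (cong (λ t → Y + -1ℤ * (t * f (suc N) zero)) (deg (suc N) ℕₚ.≤-refl)) (ℤₚ.+-identityʳ Y))) ⟩
  X + Y
    ≡⟨ antidiagonal-+ N (λ i k → u i * f (suc i) k) (λ i k → -1ℤ * (u i * f i (suc k))) ⟨
  Antidiagonal N (λ i k → u i * f (suc i) k + -1ℤ * (u i * f i (suc k)))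
    ≡⟨ antidiagonal-cong N (λ i k _ → collect (u i) (f (suc i) k) (f i (suc k))) ⟩
  Antidiagonal N (λ i k → u i * (f (suc i) k - f i (suc k))) ∎
  where
  X = Antidiagonal N (λ i k → u i * f (suc i) k)
  Y = Antidiagonal N (λ i k → -1ℤ * (u i * f i (suc k)))
  expand : ∀ a b e → (a - b) * e ≡ a * e + -1ℤ * (b * e)
  expand = solve-∀
  collect : ∀ a b e → a * b + -1ℤ * (a * e) ≡ a * (b - e)
  collect = solve-∀

binom : ℕ → ℕ → ℤ
binom n k = pos (n C k)

binom-pascal : ∀ n k → binom (suc n) (suc k) ≡ binom n k + binom n (suc k)
binom-pascal n k = cong pos (sym (nCk+nC[k+1]≡[n+1]C[k+1] n k))

-- With σ the shift F ↦ F ∘ suc, both sides are the coefficient of xᵃ in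
-- (xσ - σ)ᵐ (1 + σ)ᴹ F, the left one after expanding xσ - σ as (1 + xσ) - (1 + σ).
antidiagonal-c : ∀ m M a (F : ℕ → ℤ) →
  Antidiagonal (m ℕ.+ M) (λ i k → c m i * (binom i a * Cube k (λ s → F (a ℕ.+ s)))) ≡
  c m a * Cube M (λ s → F (m ℕ.+ s))
antidiagonal-c zero M zero F =
  antidiagonal-one M (λ i k → binom i zero * Cube k F)
antidiagonal-c zero M (suc a) F = begin
  Antidiagonal M (λ i k → one i * (binom i (suc a) * Cube k (λ s → F (suc a ℕ.+ s))))
    ≡⟨ antidiagonal-one M (λ i k → binom i (suc a) * Cube k (λ s → F (suc a ℕ.+ s))) ⟩
  binom zero (suc a) * Cube M (λ s → F (suc a ℕ.+ s))
    ≡⟨ cong (λ t → pos t * Cube M (λ s → F (suc a ℕ.+ s))) (k>n⇒nCk≡0 {zero} {suc a} (ℕ.s≤s ℕ.z≤n)) ⟩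
  0ℤ ∎
antidiagonal-c (suc m) M zero F = begin
  Antidiagonal (suc (m ℕ.+ M)) (λ i k → (δ c m) i * (1ℤ * Cube k F))
    ≡⟨ antidiagonal-δ (λ i m+M<i → c-degree m i (ℕₚ.≤-<-trans (ℕₚ.m≤m+n m M) m+M<i)) (λ i k → 1ℤ * Cube k F) ⟩
  Antidiagonal (m ℕ.+ M) (λ i k → c m i * (1ℤ * Cube k F - 1ℤ * (Cube k F + Cube k (F ∘ suc))))
    ≡⟨ antidiagonal-cong (m ℕ.+ M) (λ i k _ → cancel (c m i) (Cube k F) (Cube k (F ∘ suc))) ⟩
  Antidiagonal (m ℕ.+ M) (λ i k → -1ℤ * (c m i * (1ℤ * Cube k (F ∘ suc))))
    ≡⟨ antidiagonal-* (m ℕ.+ M) -1ℤ (λ i k → c m i * (1ℤ * Cube k (F ∘ suc))) ⟩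
  -1ℤ * Antidiagonal (m ℕ.+ M) (λ i k → c m i * (1ℤ * Cube k (F ∘ suc)))
    ≡⟨ cong (-1ℤ *_) (antidiagonal-c m M zero (F ∘ suc)) ⟩
  -1ℤ * (c m zero * Cube M (λ s → F (suc m ℕ.+ s)))
    ≡⟨ factor (c m zero) _ ⟩
  (δ c m) zero * Cube M (λ s → F (suc m ℕ.+ s)) ∎
  where
  cancel : ∀ a b e → a * (1ℤ * b - 1ℤ * (b + e)) ≡ -1ℤ * (a * (1ℤ * e))
  cancel = solve-∀
  factor : ∀ a b → -1ℤ * (a * b) ≡ (0ℤ - a) * b
  factor = solve-∀
antidiagonal-c (suc m) M (suc a) F = begin
  Antidiagonal (suc (m ℕ.+ M)) (λ i k → (δ c m) i * (binom i (suc a) * P k))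
    ≡⟨ antidiagonal-δ (λ i m+M<i → c-degree m i (ℕₚ.≤-<-trans (ℕₚ.m≤m+n m M) m+M<i)) (λ i k → binom i (suc a) * P k) ⟩
  Antidiagonal (m ℕ.+ M) (λ i k → c m i * (binom (suc i) (suc a) * P k - binom i (suc a) * (P k + Q k)))
    ≡⟨ antidiagonal-cong (m ℕ.+ M) (λ i k _ → trans
         (cong (λ t → c m i * (t * P k - binom i (suc a) * (P k + Q k))) (binom-pascal i a))
         (cancel (c m i) (binom i a) (binom i (suc a)) (P k) (Q k))) ⟩
  Antidiagonal (m ℕ.+ M) (λ i k → c m i * (binom i a * P k) + -1ℤ * (c m i * (binom i (suc a) * Q k)))
    ≡⟨ antidiagonal-+ (m ℕ.+ M) (λ i k → c m i * (binom i a * P k)) (λ i k → -1ℤ * (c m i * (binom i (suc a) * Q k))) ⟩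
  Antidiagonal (m ℕ.+ M) (λ i k → c m i * (binom i a * P k)) +
  Antidiagonal (m ℕ.+ M) (λ i k → -1ℤ * (c m i * (binom i (suc a) * Q k)))
    ≡⟨ cong₂ _+_
         (antidiagonal-c m M a (F ∘ suc))
         (trans (antidiagonal-* (m ℕ.+ M) -1ℤ (λ i k → c m i * (binom i (suc a) * Q k)))
                (cong (-1ℤ *_) (trans
                  (antidiagonal-cong (m ℕ.+ M) (λ i k _ → cong (λ t → c m i * (binom i (suc a) * t))
                     (Cube-cong k (λ s _ → cong (F ∘ suc) (ℕₚ.+-suc a s)))))
                  (antidiagonal-c m M (suc a) (F ∘ suc))))) ⟩
  c m a * R + -1ℤ * (c m (suc a) * R)
    ≡⟨ factor (c m a) (c m (suc a)) R ⟩
  (δ c m) (suc a) * R ∎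
  where
  P Q : ℕ → ℤ
  P k = Cube k (λ s → F (suc a ℕ.+ s))
  Q k = Cube k (λ s → F (suc a ℕ.+ suc s))
  R = Cube M (λ s → F (suc m ℕ.+ s))
  cancel : ∀ z b b′ p q → z * ((b + b′) * p - b′ * (p + q)) ≡ z * (b * p) + -1ℤ * (z * (b′ * q))
  cancel = solve-∀
  factor : ∀ a b r → a * r + -1ℤ * (b * r) ≡ (a - b) * r
  factor = solve-∀

𝟙 : {A : Set} → Dec A → ℤ
𝟙 d = if does d then 1ℤ else 0ℤ

𝟙-yes : ∀ {A : Set} (d : Dec A) → A → 𝟙 d ≡ 1ℤ
𝟙-yes (yes _) a = refl
𝟙-yes (no ¬a) a = contradiction a ¬a

𝟙-no : ∀ {A : Set} (d : Dec A) → ¬ A → 𝟙 d ≡ 0ℤ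
𝟙-no (yes a) ¬a = contradiction a ¬a
𝟙-no (no _)  ¬a = refl

Cube-≟ : ∀ M j → Cube M (λ s → 𝟙 (s ℕₚ.≟ j)) ≡ binom M j
Cube-≟ zero    zero    = refl
Cube-≟ zero    (suc j) = refl
Cube-≟ (suc M) zero    = trans
  (cong₂ _+_ (Cube-≟ M zero) (Cube-* M 0ℤ (λ _ → 0ℤ)))
  (ℤₚ.+-identityʳ 1ℤ)
Cube-≟ (suc M) (suc j) = begin
  Cube M (λ s → 𝟙 (s ℕₚ.≟ suc j)) + Cube M (λ s → 𝟙 (suc s ℕₚ.≟ suc j))
    ≡⟨ cong₂ _+_ (Cube-≟ M (suc j)) (Cube-≟ M j) ⟩
  binom M (suc j) + binom M j
    ≡⟨ ℤₚ.+-comm (binom M (suc j)) (binom M j) ⟩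
  binom M j + binom M (suc j)
    ≡⟨ binom-pascal M j ⟨
  binom (suc M) (suc j) ∎

sgn² : ∀ k → sgn k * sgn k ≡ 1ℤ
sgn² zero    = refl
sgn² (suc k) = trans (square (sgn k)) (sgn² k)
  where
  square : ∀ a → -1ℤ * a * (-1ℤ * a) ≡ a * a
  square = solve-∀

sgn-+ : ∀ j k → sgn (j ℕ.+ k) ≡ sgn j * sgn k
sgn-+ = ℤₚ.^-distribˡ-+-* -1ℤ

-- For t = ρ(r), the weight with which the coefficient of x^j in `D r` enters `∑B p`.
signedTail : ℕ → ℕ → ℤ
signedTail j t = sgn t * 𝟙 (j ℕ.+ j ℕₚ.<? t)

-- Neighbouring terms have opposite signs and cancel once both exceed the threshold 2j. Only at s =
-- j is the first one excluded and the second included, with sign (-1)^{2j + 1}.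
signedTail-suc : ∀ j s → signedTail j (j ℕ.+ s) + signedTail j (j ℕ.+ suc s) ≡ -1ℤ * 𝟙 (s ℕₚ.≟ j)
signedTail-suc j s with ℕₚ.<-cmp s j
... | tri< s<j s≢j _
    rewrite 𝟙-no (j ℕ.+ j ℕₚ.<? j ℕ.+ s) (ℕₚ.<⇒≯ (ℕₚ.+-monoʳ-< j s<j))
          | 𝟙-no (j ℕ.+ j ℕₚ.<? j ℕ.+ suc s) (ℕₚ.≤⇒≯ (ℕₚ.+-monoʳ-≤ j s<j))
          | 𝟙-no (s ℕₚ.≟ j) s≢j
          = cong₂ _+_ (ℤₚ.*-zeroʳ (sgn (j ℕ.+ s))) (ℤₚ.*-zeroʳ (sgn (j ℕ.+ suc s)))
... | tri≈ _ refl _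
    rewrite 𝟙-no (j ℕ.+ j ℕₚ.<? j ℕ.+ j) (ℕₚ.<-irrefl refl)
          | 𝟙-yes (j ℕ.+ j ℕₚ.<? j ℕ.+ suc j) (ℕₚ.+-monoʳ-< j ℕₚ.≤-refl)
          | 𝟙-yes (j ℕₚ.≟ j) refl
          | ℕₚ.+-suc j j
          | sgn-+ j j
          | sgn² j
          = refl
... | tri> _ s≢j j<s
    rewrite 𝟙-yes (j ℕ.+ j ℕₚ.<? j ℕ.+ s) (ℕₚ.+-monoʳ-< j j<s)
          | 𝟙-yes (j ℕ.+ j ℕₚ.<? j ℕ.+ suc s) (ℕₚ.+-monoʳ-< j (ℕₚ.m<n⇒m<1+n j<s))
          | 𝟙-no (s ℕₚ.≟ j) s≢j
          | ℕₚ.+-suc j s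
          = cancel (sgn (j ℕ.+ s))
  where
  cancel : ∀ a → a * 1ℤ + -1ℤ * a * 1ℤ ≡ 0ℤ
  cancel = solve-∀

-- Pairing the subsets that differ in one fixed element makes `signedTail-suc` applicable. What
-- survives are the j-element subsets of the remaining k - 1 elements, each with weight -1.
Cube-signedTail : ∀ k j → Cube k (λ s → signedTail j (j ℕ.+ s)) ≡ -1ℤ * pos (predBinom k j)
Cube-signedTail zero j = begin
  sgn (j ℕ.+ 0) * 𝟙 (j ℕ.+ j ℕₚ.<? j ℕ.+ 0)
    ≡⟨ cong (sgn (j ℕ.+ 0) *_) (𝟙-no (j ℕ.+ j ℕₚ.<? j ℕ.+ 0) (ℕₚ.≤⇒≯ (ℕₚ.+-monoʳ-≤ j ℕ.z≤n))) ⟩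
  sgn (j ℕ.+ 0) * 0ℤ
    ≡⟨ ℤₚ.*-zeroʳ (sgn (j ℕ.+ 0)) ⟩
  0ℤ ∎
Cube-signedTail (suc k) j = begin
  Cube k (λ s → signedTail j (j ℕ.+ s)) + Cube k (λ s → signedTail j (j ℕ.+ suc s))
    ≡⟨ Cube-+ k (λ s → signedTail j (j ℕ.+ s)) (λ s → signedTail j (j ℕ.+ suc s)) ⟨
  Cube k (λ s → signedTail j (j ℕ.+ s) + signedTail j (j ℕ.+ suc s))
    ≡⟨ Cube-cong k (λ s _ → signedTail-suc j s) ⟩
  Cube k (λ s → -1ℤ * 𝟙 (s ℕₚ.≟ j))
    ≡⟨ Cube-* k -1ℤ (λ s → 𝟙 (s ℕₚ.≟ j)) ⟩
  -1ℤ * Cube k (λ s → 𝟙 (s ℕₚ.≟ j))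
    ≡⟨ cong (-1ℤ *_) (Cube-≟ k j) ⟩
  -1ℤ * binom k j ∎

-- Folding the sum about its middle turns it into half the sum of the products
-- -(D i)(E i k - E k i), where E i k = (i C j) predBinom k j.
antidiagonal-antisymmetric-nonneg : ∀ N j (D : Series) →
  (∀ i k → i ℕ.+ k ≡ N → D k ≡ - D i) →
  (∀ i k → i ℕ.+ k ≡ N → i <ℕ k → D i ≤ 0ℤ) →
  0ℤ ≤ Antidiagonal N (λ i k → D i * (binom i j * (-1ℤ * pos (predBinom k j))))
antidiagonal-antisymmetric-nonneg N j D anti D≤0 = halve (Antidiagonal N T) (subst (0ℤ ≤_)
  (trans (antidiagonal-+ N T (flip T)) (cong (Antidiagonal N T +_) (antidiagonal-flip N T)))
  (antidiagonal-nonneg N λ i k i+k≡N → folded i k i+k≡N))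
  where
  T : ℕ → ℕ → ℤ
  T i k = D i * (binom i j * (-1ℤ * pos (predBinom k j)))
  E : ℕ → ℕ → ℤ
  E i k = binom i j * pos (predBinom k j)
  halve : ∀ a → 0ℤ ≤ a + a → 0ℤ ≤ a
  halve (pos a) _ = ℤ.+≤+ ℕ.z≤n
  T+T : ∀ i k → i ℕ.+ k ≡ N → T i k + T k i ≡ (- D i) * (E i k - E k i)
  T+T i k i+k≡N = trans (cong (λ d → T i k + d * (binom k j * (-1ℤ * pos (predBinom i j)))) (anti i k i+k≡N))
    (expand (D i) (binom i j) (pos (predBinom k j)) (binom k j) (pos (predBinom i j)))
    where
    expand : ∀ d a b a′ b′ → d * (a * (-1ℤ * b)) + (- d) * (a′ * (-1ℤ * b′)) ≡ (- d) * (a * b - a′ * b′)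
    expand = solve-∀
  E-mono : ∀ {i k} → i ℕ.≤ k → 0ℤ ≤ E i k - E k i
  E-mono {i} {k} i≤k = ℤₚ.i≤j⇒0≤j-i (subst₂ _≤_
    (ℤₚ.pos-* (k C j) (predBinom i j)) (ℤₚ.pos-* (i C j) (predBinom k j))
    (ℤ.+≤+ (binom-predBinom-mono j i≤k)))
  lower : ∀ i k → i ℕ.+ k ≡ N → i <ℕ k → 0ℤ ≤ T i k + T k i
  lower i k i+k≡N i<k = subst (0ℤ ≤_) (sym (T+T i k i+k≡N))
    (0≤*0≤ (ℤₚ.neg-mono-≤ (D≤0 i k i+k≡N i<k)) (E-mono (ℕₚ.<⇒≤ i<k)))
    where
    0≤*0≤ : ∀ {a b} → 0ℤ ≤ a → 0ℤ ≤ b → 0ℤ ≤ a * b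
    0≤*0≤ {pos a} {pos b} _ _ = subst (0ℤ ≤_) (ℤₚ.pos-* a b) (ℤ.+≤+ ℕ.z≤n)
  folded : ∀ i k → i ℕ.+ k ≡ N → 0ℤ ≤ T i k + T k i
  folded i k i+k≡N with ℕₚ.<-cmp i k
  ... | tri< i<k _ _ = lower i k i+k≡N i<k
  ... | tri≈ _ refl _ = ℤₚ.≤-reflexive (sym (trans (T+T i i i+k≡N) (vanish (D i) (E i i))))
    where
    vanish : ∀ d e → (- d) * (e - e) ≡ 0ℤ
    vanish = solve-∀
  ... | tri> _ _ k<i = subst (0ℤ ≤_) (ℤₚ.+-comm (T k i) (T i k)) (lower k i (trans (ℕₚ.+-comm k i) i+k≡N) k<i)

-- Lower halves of antipalindromic polynomials

truncate : ℕ → Series → Series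
truncate N u i = 𝟙 (i ℕ.+ i ℕₚ.<? N) * u i

-- By antisymmetry the reversed lower half is minus the upper half, so adding u leaves the lower
-- half. For even N the middle coefficient equals its own negative and is therefore 0.
rev-truncate : ∀ {N u} → Degree≤ N u → (rev N u ≗ λ i → - u i) →
  ∀ i → rev N (truncate N u) i + u i ≡ truncate N u i
rev-truncate {N} {u} deg anti i with i ℕₚ.≤? N
... | no i≰N rewrite rev-> (truncate N u) i (ℕₚ.≰⇒> i≰N) | deg i (ℕₚ.≰⇒> i≰N) = sym (ℤₚ.*-zeroʳ (𝟙 (i ℕ.+ i ℕₚ.<? N)))
... | yes i≤N = begin
  rev N (truncate N u) i + u i
    ≡⟨ cong (_+ u i) (rev-≤ (truncate N u) i≤N) ⟩
  𝟙 (k ℕ.+ k ℕₚ.<? N) * u k + u i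
    ≡⟨ cong (λ v → 𝟙 (k ℕ.+ k ℕₚ.<? N) * v + u i) u[k] ⟩
  𝟙 (k ℕ.+ k ℕₚ.<? N) * (- u i) + u i
    ≡⟨ cases ⟩
  𝟙 (i ℕ.+ i ℕₚ.<? N) * u i ∎
  where
  k = N ∸ i
  i+k≡N : i ℕ.+ k ≡ N
  i+k≡N = ℕₚ.m+[n∸m]≡n i≤N
  k+i≡N : k ℕ.+ i ≡ N
  k+i≡N = ℕₚ.m∸n+n≡m i≤N
  u[k] : u k ≡ - u i
  u[k] = trans (sym (rev-≤ u i≤N)) (anti i)
  cancel : ∀ a → 1ℤ * (- a) + a ≡ 0ℤ
  cancel = solve-∀
  self-negative : ∀ a → a ≡ - a → a ≡ 0ℤ
  self-negative (pos zero) _ = refl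
  self-negative (pos (suc n)) ()
  cases : 𝟙 (k ℕ.+ k ℕₚ.<? N) * (- u i) + u i ≡ 𝟙 (i ℕ.+ i ℕₚ.<? N) * u i
  cases with ℕₚ.<-cmp i k
  ... | tri< i<k _ _
      rewrite 𝟙-yes (i ℕ.+ i ℕₚ.<? N) (subst (i ℕ.+ i <ℕ_) i+k≡N (ℕₚ.+-monoʳ-< i i<k))
            | 𝟙-no (k ℕ.+ k ℕₚ.<? N) (ℕₚ.<⇒≯ (subst (_<ℕ k ℕ.+ k) i+k≡N (ℕₚ.+-monoˡ-< k i<k)))
            = trans (ℤₚ.+-identityˡ (u i)) (sym (ℤₚ.*-identityˡ (u i)))
  ... | tri≈ _ i≡k _
      rewrite self-negative (u i) (trans (cong u i≡k) u[k])
            = trans (cong (_+ 0ℤ) (ℤₚ.*-zeroʳ (𝟙 (k ℕ.+ k ℕₚ.<? N)))) (sym (ℤₚ.*-zeroʳ (𝟙 (i ℕ.+ i ℕₚ.<? N))))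
  ... | tri> _ _ k<i
      rewrite 𝟙-yes (k ℕ.+ k ℕₚ.<? N) (subst (k ℕ.+ k <ℕ_) k+i≡N (ℕₚ.+-monoʳ-< k k<i))
            | 𝟙-no (i ℕ.+ i ℕₚ.<? N) (ℕₚ.<⇒≯ (subst (_<ℕ i ℕ.+ i) k+i≡N (ℕₚ.+-monoˡ-< i k<i)))
            = cancel (u i)

𝟙-cong : ∀ {A B : Set} (d : Dec A) (e : Dec B) → (A → B) → (B → A) → 𝟙 d ≡ 𝟙 e
𝟙-cong (yes a) e f g = sym (𝟙-yes e (f a))
𝟙-cong (no ¬a) e f g = sym (𝟙-no e (¬a ∘ g))

𝟙*-cong : ∀ {A : Set} (d : Dec A) {x y} → (A → x ≡ y) → 𝟙 d * x ≡ 𝟙 d * y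
𝟙*-cong (yes a) x≡y = cong (1ℤ *_) (x≡y a)
𝟙*-cong (no _)  _   = refl

-- Sums over finite sets and over subsets of finite sets

sum-0 : ∀ {n} {f : Fin n → ℤ} → (∀ r → f r ≡ 0ℤ) → sum f ≡ 0ℤ
sum-0 {n} f≗0 = trans (sum-cong-≗ f≗0) (sum-replicate-zero n)

sum-single : ∀ {n} (r₀ : Fin n) {f : Fin n → ℤ} → (∀ r → r ≢ r₀ → f r ≡ 0ℤ) → sum f ≡ f r₀
sum-single zero     {f} f≡0 = trans
  (cong (f zero +_) (sum-0 (λ r → f≡0 (suc r) λ ())))
  (ℤₚ.+-identityʳ (f zero))
sum-single (suc r₀) {f} f≡0 = trans
  (cong₂ _+_ (f≡0 zero λ ()) (sum-single r₀ (λ r r≢r₀ → f≡0 (suc r) (r≢r₀ ∘ Finₚ.suc-injective))))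
  (ℤₚ.+-identityˡ (f (suc r₀)))

sumSubsets : ∀ k → (Subset k → ℤ) → ℤ
sumSubsets zero    f = f []
sumSubsets (suc k) f = sumSubsets k (f ∘ (outside ∷_)) + sumSubsets k (f ∘ (inside ∷_))

sumSubsets-cong : ∀ k {f g} → f ≗ g → sumSubsets k f ≡ sumSubsets k g
sumSubsets-cong zero    f≗g = f≗g []
sumSubsets-cong (suc k) f≗g = cong₂ _+_ (sumSubsets-cong k (f≗g ∘ (outside ∷_))) (sumSubsets-cong k (f≗g ∘ (inside ∷_)))

sumSubsets-0 : ∀ k {f} → (∀ S → f S ≡ 0ℤ) → sumSubsets k f ≡ 0ℤ
sumSubsets-0 zero    f≗0 = f≗0 []
sumSubsets-0 (suc k) f≗0 = cong₂ _+_ (sumSubsets-0 k (f≗0 ∘ (outside ∷_))) (sumSubsets-0 k (f≗0 ∘ (inside ∷_)))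

sumSubsets-single : ∀ {k} (T : Subset k) {f} → (∀ S → S ≢ T → f S ≡ 0ℤ) → sumSubsets k f ≡ f T
sumSubsets-single [] f≡0 = refl
sumSubsets-single {suc k} (outside ∷ T) {f} f≡0 = trans
  (cong₂ _+_ (sumSubsets-single T (λ S S≢T → f≡0 (outside ∷ S) (S≢T ∘ ∷-injectiveʳ)))
             (sumSubsets-0 k (λ S → f≡0 (inside ∷ S) λ ())))
  (ℤₚ.+-identityʳ (f (outside ∷ T)))
sumSubsets-single {suc k} (inside ∷ T) {f} f≡0 = trans
  (cong₂ _+_ (sumSubsets-0 k (λ S → f≡0 (outside ∷ S) λ ()))
             (sumSubsets-single T (λ S S≢T → f≡0 (inside ∷ S) (S≢T ∘ ∷-injectiveʳ))))
  (ℤₚ.+-identityˡ (f (inside ∷ T)))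

sum-sumSubsets : ∀ {n} k (f : Fin n → Subset k → ℤ) →
  sum (λ r → sumSubsets k (f r)) ≡ sumSubsets k (λ S → sum (λ r → f r S))
sum-sumSubsets zero    f = refl
sum-sumSubsets (suc k) f = trans
  (∑-distrib-+ (λ r → sumSubsets k (f r ∘ (outside ∷_))) (λ r → sumSubsets k (f r ∘ (inside ∷_))))
  (cong₂ _+_ (sum-sumSubsets k (λ r → f r ∘ (outside ∷_))) (sum-sumSubsets k (λ r → f r ∘ (inside ∷_))))

sumSubsets-⊆ : ∀ {k} (T : Subset k) F → sumSubsets k (λ S → 𝟙 (S ⊆? T) * F ∣ S ∣) ≡ Cube ∣ T ∣ F
sumSubsets-⊆ []            F = ℤₚ.*-identityˡ (F 0)
sumSubsets-⊆ {suc k} (outside ∷ T) F = trans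
  (cong₂ _+_ (sumSubsets-⊆ T F) (sumSubsets-0 k (λ S → refl)))
  (ℤₚ.+-identityʳ (Cube ∣ T ∣ F))
sumSubsets-⊆ (inside ∷ T)  F = cong₂ _+_ (sumSubsets-⊆ T F) (sumSubsets-⊆ T (F ∘ suc))

-- Covers in a Boolean algebra

infix 4 _⋖ₛ_
data _⋖ₛ_ : ∀ {k} → Subset k → Subset k → Set where
  add  : ∀ {k} {S : Subset k} → outside ∷ S ⋖ₛ inside ∷ S
  skip : ∀ {k b} {S T : Subset k} → S ⋖ₛ T → b ∷ S ⋖ₛ b ∷ T

⋖ₛ⇒⊆ : ∀ {k} {S T : Subset k} → S ⋖ₛ T → S ⊆ T
⋖ₛ⇒⊆ add      = out⊆ id
⋖ₛ⇒⊆ (skip c) = s⊆s (⋖ₛ⇒⊆ c)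

⋖ₛ⇒⊉ : ∀ {k} {S T : Subset k} → S ⋖ₛ T → ¬ T ⊆ S
⋖ₛ⇒⊉ add      T⊆S with () ← T⊆S here
⋖ₛ⇒⊉ (skip c) T⊆S = ⋖ₛ⇒⊉ c (drop-∷-⊆ T⊆S)

⋖ₛ-between : ∀ {k} {S T Z : Subset k} → S ⋖ₛ T → S ⊆ Z → Z ⊆ T → Z ≡ S ⊎ Z ≡ T
⋖ₛ-between {Z = outside ∷ Z} add S⊆Z Z⊆T = inj₁ (cong (outside ∷_) (⊆-antisym (drop-∷-⊆ Z⊆T) (drop-∷-⊆ S⊆Z)))
⋖ₛ-between {Z = inside ∷ Z}  add S⊆Z Z⊆T = inj₂ (cong (inside ∷_) (⊆-antisym (drop-∷-⊆ Z⊆T) (drop-∷-⊆ S⊆Z)))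
⋖ₛ-between {Z = inside ∷ Z}  (skip {b = outside} c) S⊆Z Z⊆T with () ← Z⊆T here
⋖ₛ-between {Z = outside ∷ Z} (skip {b = inside}  c) S⊆Z Z⊆T with () ← S⊆Z here
⋖ₛ-between {Z = outside ∷ Z} (skip {b = outside} c) S⊆Z Z⊆T =
  Sum.map (cong (outside ∷_)) (cong (outside ∷_)) (⋖ₛ-between c (drop-∷-⊆ S⊆Z) (drop-∷-⊆ Z⊆T))
⋖ₛ-between {Z = inside ∷ Z}  (skip {b = inside}  c) S⊆Z Z⊆T =
  Sum.map (cong (inside ∷_)) (cong (inside ∷_)) (⋖ₛ-between c (drop-∷-⊆ S⊆Z) (drop-∷-⊆ Z⊆T))

-- Induction on the subset, with r restricted to the face that fixes the first element as in or out.
-- The bottom of the inside face covers `⊥`, which accounts for the extra 1.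
⋖ₛ-rank : ∀ {k} (r : Subset k → ℕ) → (∀ {S T} → S ⋖ₛ T → r T ≡ suc (r S)) → ∀ S → r S ≡ r ⊥ ℕ.+ ∣ S ∣
⋖ₛ-rank r r-⋖ []            = sym (ℕₚ.+-identityʳ (r []))
⋖ₛ-rank r r-⋖ (outside ∷ S) = ⋖ₛ-rank (r ∘ (outside ∷_)) (r-⋖ ∘ skip) S
⋖ₛ-rank r r-⋖ (inside ∷ S)  = begin
  r (inside ∷ S)                     ≡⟨ ⋖ₛ-rank (r ∘ (inside ∷_)) (r-⋖ ∘ skip) S ⟩
  r (inside ∷ ⊥) ℕ.+ ∣ S ∣            ≡⟨ cong (λ t → t ℕ.+ ∣ S ∣) (r-⋖ add) ⟩
  suc (r (outside ∷ ⊥) ℕ.+ ∣ S ∣)     ≡⟨ ℕₚ.+-suc (r (outside ∷ ⊥)) ∣ S ∣ ⟨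
  r (outside ∷ ⊥) ℕ.+ suc ∣ S ∣       ∎

-- Sums over intervals [t, p] with [t, 1̂] Boolean

module BooleanInterval (P : GradedPoset) {t} (t-boolean : IsBooleanInterval P t (GradedPoset.1̂ P)) where
  open GradedPoset P
  private
    module ⊑ = IsPartialOrder isPartialOrder
    k = proj₁ t-boolean
    φ = proj₁ (proj₂ t-boolean)
    open IsOrderIsomorphism (proj₂ (proj₂ t-boolean)) renaming (cong to φ-cong)

    φ⁻¹ : Subset k → Interval P t 1̂
    φ⁻¹ S = proj₁ (surjective S)

    φ∘φ⁻¹ : ∀ S → φ (φ⁻¹ S) ≡ S
    φ∘φ⁻¹ S = proj₂ (surjective S) refl

    el : Subset k → Fin size
    el S = proj₁ (φ⁻¹ S)

    el-mono : ∀ {S T} → S ⊆ T → el S ⊑ el T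
    el-mono S⊆T = cancel (subst₂ _⊆_ (sym (φ∘φ⁻¹ _)) (sym (φ∘φ⁻¹ _)) S⊆T)

    el-cancel : ∀ {S T} → el S ⊑ el T → S ⊆ T
    el-cancel S⊑T = subst₂ _⊆_ (φ∘φ⁻¹ _) (φ∘φ⁻¹ _) (mono S⊑T)

    el∘φ : ∀ x → el (φ x) ≡ proj₁ x
    el∘φ x = injective (φ∘φ⁻¹ (φ x))

    above : ∀ {r} → t ⊑ r → Interval P t 1̂
    above {r} t⊑r = r , t⊑r , 1̂-maximum r

    -- The rank function of P is prescribed only along covers, so reading off ranks from
    -- cardinalities requires the inverse of φ to preserve covers.
    el-⋖ : ∀ {S T} → S ⋖ₛ T → el S ⋖ el T
    el-⋖ {S} {T} S⋖T =
      (el-mono (⋖ₛ⇒⊆ S⋖T) , λ S≡T → ⋖ₛ⇒⊉ S⋖T (el-cancel (⊑.reflexive (sym S≡T)))) , noneBetween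
      where
      noneBetween : ∀ z → ¬ (el S ⊏ z × z ⊏ el T)
      noneBetween z ((S⊑z , S≢z) , (z⊑T , z≢T)) = Sum.[
        (λ Z≡S → S≢z (trans (cong el (sym Z≡S)) elZ≡z)) ,
        (λ Z≡T → z≢T (trans (sym elZ≡z) (cong el Z≡T))) ]
        (⋖ₛ-between S⋖T
          (el-cancel (subst (el S ⊑_) (sym elZ≡z) S⊑z))
          (el-cancel (subst (_⊑ el T) (sym elZ≡z) z⊑T)))
        where
        z∈ = above (⊑.trans (proj₁ (proj₂ (φ⁻¹ S))) S⊑z)
        elZ≡z = el∘φ z∈

    el-⊥ : el ⊥ ≡ t
    el-⊥ = ⊑.antisym
      (subst (el ⊥ ⊑_) (el∘φ (above ⊑.refl)) (el-mono (⊆-min _)))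
      (proj₁ (proj₂ (φ⁻¹ ⊥)))

    ρ-el : ∀ S → ρ (el S) ≡ ρ t ℕ.+ ∣ S ∣
    ρ-el S = trans (⋖ₛ-rank (ρ ∘ el) (ρ-⋖ ∘ el-⋖) S) (cong (λ x → ρ x ℕ.+ ∣ S ∣) el-⊥)

    -- As φ is a bijection, `𝟙 (t ⊑? r)` counts the subsets S with `el S` equal to r; the two
    -- summations are then interchanged.
    sum-above : ∀ (f : Fin size → ℤ) → sum (λ r → 𝟙 (t ⊑? r) * f r) ≡ sumSubsets k (f ∘ el)
    sum-above f = begin
      sum (λ r → 𝟙 (t ⊑? r) * f r)
        ≡⟨ sum-cong-≗ fibre ⟩
      sum (λ r → sumSubsets k (λ S → 𝟙 (el S Finₚ.≟ r) * f r))
        ≡⟨ sum-sumSubsets k (λ r S → 𝟙 (el S Finₚ.≟ r) * f r) ⟩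
      sumSubsets k (λ S → sum (λ r → 𝟙 (el S Finₚ.≟ r) * f r))
        ≡⟨ sumSubsets-cong k (λ S → trans
             (sum-single (el S) λ r r≢elS → cong (λ e → e * f r) (𝟙-no (el S Finₚ.≟ r) (r≢elS ∘ sym)))
             (trans (cong (λ e → e * f (el S)) (𝟙-yes (el S Finₚ.≟ el S) refl)) (ℤₚ.*-identityˡ (f (el S))))) ⟩
      sumSubsets k (f ∘ el) ∎
      where
      fibre : ∀ r → 𝟙 (t ⊑? r) * f r ≡ sumSubsets k (λ S → 𝟙 (el S Finₚ.≟ r) * f r)
      fibre r with t ⊑? r
      ... | yes t⊑r = sym (trans
              (sumSubsets-single (φ (above t⊑r)) λ S S≢φr →
                cong (λ e → e * f r) (𝟙-no (el S Finₚ.≟ r) λ elS≡r → S≢φr (trans (sym (φ∘φ⁻¹ S)) (φ-cong elS≡r))))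
              (cong (λ e → e * f r) (𝟙-yes (el (φ (above t⊑r)) Finₚ.≟ r) (el∘φ (above t⊑r)))))
      ... | no t⋢r = sym (sumSubsets-0 k λ S →
              cong (λ e → e * f r) (𝟙-no (el S Finₚ.≟ r) λ { refl → t⋢r (proj₁ (proj₂ (φ⁻¹ S))) }))

  -- With T the subset of p, the elements of [t, p] are those `el S` with S ⊆ T, and their ranks are
  -- ρ(t) + |S|.
  sum-interval : ∀ {p} → t ⊑ p → (F : ℕ → ℤ) →
    sum (λ r → 𝟙 (t ⊑? r) * (𝟙 (r ⊑? p) * F (ρ r))) ≡ Cube (ρ p ∸ ρ t) (λ s → F (ρ t ℕ.+ s))
  sum-interval {p} t⊑p F = begin
    sum (λ r → 𝟙 (t ⊑? r) * (𝟙 (r ⊑? p) * F (ρ r)))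
      ≡⟨ sum-above (λ r → 𝟙 (r ⊑? p) * F (ρ r)) ⟩
    sumSubsets k (λ S → 𝟙 (el S ⊑? p) * F (ρ (el S)))
      ≡⟨ sumSubsets-cong k (λ S → cong₂ (λ a b → a * b)
           (𝟙-cong (el S ⊑? p) (S ⊆? T)
             (λ elS⊑p → el-cancel (subst (el S ⊑_) (sym elT≡p) elS⊑p))
             (λ S⊆T → subst (el S ⊑_) elT≡p (el-mono S⊆T)))
           (cong F (ρ-el S))) ⟩
    sumSubsets k (λ S → 𝟙 (S ⊆? T) * F (ρ t ℕ.+ ∣ S ∣))
      ≡⟨ sumSubsets-⊆ T (λ s → F (ρ t ℕ.+ s)) ⟩
    Cube ∣ T ∣ (λ s → F (ρ t ℕ.+ s))
      ≡⟨ cong (λ M → Cube M (λ s → F (ρ t ℕ.+ s))) ∣T∣ ⟩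
    Cube (ρ p ∸ ρ t) (λ s → F (ρ t ℕ.+ s)) ∎
    where
    T = φ (above t⊑p)
    elT≡p = el∘φ (above t⊑p)
    ∣T∣ : ∣ T ∣ ≡ ρ p ∸ ρ t
    ∣T∣ = begin
      ∣ T ∣                        ≡⟨ ℕₚ.m+n∸m≡n (ρ t) ∣ T ∣ ⟨
      ρ t ℕ.+ ∣ T ∣ ∸ ρ t          ≡⟨ cong (_∸ ρ t) (ρ-el T) ⟨
      ρ (el T) ∸ ρ t               ≡⟨ cong (λ x → ρ x ∸ ρ t) elT≡p ⟩
      ρ p ∸ ρ t                    ∎

𝟙-× : ∀ {A B : Set} (d : Dec A) (e : Dec B) y → 𝟙 d * (𝟙 e * y) ≡ 𝟙 (d ×-dec e) * y
𝟙-× (yes _) e y = ℤₚ.*-identityˡ (𝟙 e * y)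
𝟙-× (no _)  e y = refl

∑ℤ-filter : ∀ {A : Set} {Q : A → Set} (Q? : ∀ x → Dec (Q x)) (f : A → ℤ) {n} (h : Fin n → A) →
  ∑ℤ (List.map f (List.filter Q? (List.tabulate h))) ≡ sum (λ r → 𝟙 (Q? (h r)) * f (h r))
∑ℤ-filter Q? f {zero}  h = refl
∑ℤ-filter Q? f {suc n} h with Q? (h zero)
... | yes _ = cong₂ _+_ (sym (ℤₚ.*-identityˡ (f (h zero)))) (∑ℤ-filter Q? f (h ∘ suc))
... | no  _ = trans (∑ℤ-filter Q? f (h ∘ suc)) (sym (ℤₚ.+-identityˡ (sum λ r → 𝟙 (Q? (h (suc r))) * f (h (suc r)))))

-- Sums over half-open intervals (0̂, p]

module HalfOpen (P : GradedPoset) where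
  open GradedPoset P
  open IsPartialOrder isPartialOrder using () renaming (trans to ⊑-trans; antisym to ⊑-antisym)

  ρ-mono : ∀ {q p} → q ⊑ p → ρ q ℕ.≤ ρ p
  ρ-mono {q} {p} q⊑p with q ≟ p
  ... | yes refl = ℕₚ.≤-refl
  ... | no q≢p   = ℕₚ.<⇒≤ (ρ-mono-⊏ (q⊑p , q≢p))

  infix 4 _∈⟨0̂,_]?
  _∈⟨0̂,_]? : ∀ q p → Dec (q ≢ 0̂ × q ⊑ p)
  q ∈⟨0̂, p ]? = ¬? (q ≟ 0̂) ×-dec (q ⊑? p)

  ∑₊ : Fin size → (Fin size → ℤ) → ℤ
  ∑₊ p f = sum λ q → 𝟙 (q ∈⟨0̂, p ]?) * f q

  ∑₊-cong : ∀ p {f g} → (∀ q → q ≢ 0̂ → q ⊑ p → f q ≡ g q) → ∑₊ p f ≡ ∑₊ p g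
  ∑₊-cong p f≗g = sum-cong-≗ λ q → 𝟙*-cong (q ∈⟨0̂, p ]?) λ (q≢0̂ , q⊑p) → f≗g q q≢0̂ q⊑p

  ∑₊-0 : ∀ p → ∑₊ p (λ _ → 0ℤ) ≡ 0ℤ
  ∑₊-0 p = sum-0 λ q → ℤₚ.*-zeroʳ (𝟙 (q ∈⟨0̂, p ]?))

  ∑₊-+ : ∀ p f g → ∑₊ p (λ q → f q + g q) ≡ ∑₊ p f + ∑₊ p g
  ∑₊-+ p f g = trans
    (sum-cong-≗ λ q → ℤₚ.*-distribˡ-+ (𝟙 (q ∈⟨0̂, p ]?)) (f q) (g q))
    (∑-distrib-+ (λ q → 𝟙 (q ∈⟨0̂, p ]?) * f q) (λ q → 𝟙 (q ∈⟨0̂, p ]?) * g q))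

  ∑₊-* : ∀ p a f → ∑₊ p (λ q → a * f q) ≡ a * ∑₊ p f
  ∑₊-* p a f = trans
    (sum-cong-≗ λ q → commute (𝟙 (q ∈⟨0̂, p ]?)) a (f q))
    (sym (*-distribˡ-sum a λ q → 𝟙 (q ∈⟨0̂, p ]?) * f q))
    where
    commute : ∀ a b d → a * (b * d) ≡ b * (a * d)
    commute = solve-∀

  ∑₊-*ʳ : ∀ p f a → ∑₊ p (λ q → f q * a) ≡ ∑₊ p f * a
  ∑₊-*ʳ p f a = trans
    (∑₊-cong p λ q _ _ → ℤₚ.*-comm (f q) a)
    (trans (∑₊-* p a f) (ℤₚ.*-comm a (∑₊ p f)))

  ∑₊-linear : ∀ {L} → Linear L → ∀ p (u : Fin size → Series) i →
    L (λ i → ∑₊ p (λ q → u q i)) i ≡ ∑₊ p (λ q → L (u q) i)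
  ∑₊-linear lin p u i = trans
    (sum-homo lin (λ q i → 𝟙 (q ∈⟨0̂, p ]?) * u q i) i)
    (sum-cong-≗ λ q → lin .*-homo (𝟙 (q ∈⟨0̂, p ]?)) (u q) i)

  ∑₊-antidiagonal : ∀ p N (f : Fin size → ℕ → ℕ → ℤ) →
    ∑₊ p (λ q → Antidiagonal N (f q)) ≡ Antidiagonal N (λ i k → ∑₊ p (λ q → f q i k))
  ∑₊-antidiagonal p zero    f = refl
  ∑₊-antidiagonal p (suc N) f = trans
    (∑₊-+ p (λ q → f q zero (suc N)) (λ q → Antidiagonal N (f q ∘ suc)))
    (cong (∑₊ p (λ q → f q zero (suc N)) +_) (∑₊-antidiagonal p N (λ q → f q ∘ suc)))

  sum-⊑ : ∀ p f → sum (λ q → 𝟙 (q ⊑? p) * f q) ≡ f 0̂ + ∑₊ p f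
  sum-⊑ p f = begin
    sum (λ q → 𝟙 (q ⊑? p) * f q)
      ≡⟨ sum-cong-≗ split ⟩
    sum (λ q → 𝟙 (q ≟ 0̂) * f q + 𝟙 (q ∈⟨0̂, p ]?) * f q)
      ≡⟨ ∑-distrib-+ (λ q → 𝟙 (q ≟ 0̂) * f q) (λ q → 𝟙 (q ∈⟨0̂, p ]?) * f q) ⟩
    sum (λ q → 𝟙 (q ≟ 0̂) * f q) + ∑₊ p f
      ≡⟨ cong (_+ ∑₊ p f) (sum-single 0̂ λ q q≢0̂ → cong (λ e → e * f q) (𝟙-no (q ≟ 0̂) q≢0̂)) ⟩
    𝟙 (0̂ ≟ 0̂) * f 0̂ + ∑₊ p f
      ≡⟨ cong (λ e → e * f 0̂ + ∑₊ p f) (𝟙-yes (0̂ ≟ 0̂) refl) ⟩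
    1ℤ * f 0̂ + ∑₊ p f
      ≡⟨ cong (_+ ∑₊ p f) (ℤₚ.*-identityˡ (f 0̂)) ⟩
    f 0̂ + ∑₊ p f ∎
    where
    split : ∀ q → 𝟙 (q ⊑? p) * f q ≡ 𝟙 (q ≟ 0̂) * f q + 𝟙 (q ∈⟨0̂, p ]?) * f q
    split q with q ≟ 0̂
    ... | yes refl = trans (cong (λ e → e * f 0̂) (𝟙-yes (0̂ ⊑? p) (0̂-minimum p))) (sym (ℤₚ.+-identityʳ (1ℤ * f 0̂)))
    ... | no  _    = sym (ℤₚ.+-identityˡ (𝟙 (q ⊑? p) * f q))

  D : Fin size → Series
  D p i = ∑₊ p (λ q → c (ρ q) i)

  D-degree : ∀ p → Degree≤ (ρ p) (D p)
  D-degree p i ρp<i = trans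
    (∑₊-cong p λ q _ q⊑p → c-degree (ρ q) i (ℕₚ.≤-<-trans (ρ-mono q⊑p) ρp<i))
    (∑₊-0 p)

  -- Reciprocity and coefficient formula for the candidate a(p)

  module DualSimplicial (eulerian : IsEulerian P) (dualSimplicial : IsDualSimplicial P) where

    euler : ∀ p → p ≢ 0̂ → ∑₊ p (sgn ∘ ρ) ≡ -1ℤ
    euler p p≢0̂ = solveFor (∑₊ p (sgn ∘ ρ)) (begin
      1ℤ + ∑₊ p (sgn ∘ ρ)
        ≡⟨ cong (λ k → sgn k + ∑₊ p (sgn ∘ ρ)) ρ-0̂ ⟨
      sgn (ρ 0̂) + ∑₊ p (sgn ∘ ρ)
        ≡⟨ sum-⊑ p (sgn ∘ ρ) ⟨
      sum (λ q → 𝟙 (q ⊑? p) * sgn (ρ q))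
        ≡⟨ sum-cong-≗ (λ q → cong (λ e → e * sgn (ρ q))
             (𝟙-cong (q ⊑? p) ((0̂ ⊑? q) ×-dec (q ⊑? p)) (0̂-minimum q ,_) proj₂)) ⟩
      sum (λ q → 𝟙 ((0̂ ⊑? q) ×-dec (q ⊑? p)) * sgn (ρ q))
        ≡⟨ ∑ℤ-filter (λ q → (0̂ ⊑? q) ×-dec (q ⊑? p)) (sgn ∘ ρ) id ⟨
      ∑ℤ (List.map (sgn ∘ ρ) (interval P 0̂ p))
        ≡⟨ eulerian 0̂ p (0̂-minimum p , p≢0̂ ∘ sym) ⟩
      0ℤ ∎)
      where
      solveFor : ∀ a → 1ℤ + a ≡ 0ℤ → a ≡ -1ℤ
      solveFor a eq = trans (isolate a) (cong (_- 1ℤ) eq)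
        where
        isolate : ∀ a → a ≡ 1ℤ + a - 1ℤ
        isolate = solve-∀

    -- Both sides run over the chains 0̂ < r ≤ q ≤ p. For fixed r the summand sees only the rank of
    -- q in [r, p], which is Boolean by dual simpliciality, so the sum over q is a cube sum.
    -- `rev-D`, `∑B-x^`, `∑D-x^` and `∑B-antidiagonal` all rest on this.
    ∑₊-exchange : ∀ p (Y : Fin size → ℕ → ℤ) →
      ∑₊ p (λ q → ∑₊ q (λ r → Y r (ρ q))) ≡ ∑₊ p (λ r → Cube (ρ p ∸ ρ r) (λ s → Y r (ρ r ℕ.+ s)))
    ∑₊-exchange p Y = begin
      sum (λ q → 𝟙 (q ∈⟨0̂, p ]?) * sum (λ r → 𝟙 (r ∈⟨0̂, q ]?) * Y r (ρ q)))
        ≡⟨ sum-cong-≗ (λ q → *-distribˡ-sum (𝟙 (q ∈⟨0̂, p ]?)) (λ r → 𝟙 (r ∈⟨0̂, q ]?) * Y r (ρ q))) ⟩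
      sum (λ q → sum (λ r → 𝟙 (q ∈⟨0̂, p ]?) * (𝟙 (r ∈⟨0̂, q ]?) * Y r (ρ q))))
        ≡⟨ ∑-comm (λ q r → 𝟙 (q ∈⟨0̂, p ]?) * (𝟙 (r ∈⟨0̂, q ]?) * Y r (ρ q))) ⟩
      sum (λ r → sum (λ q → 𝟙 (q ∈⟨0̂, p ]?) * (𝟙 (r ∈⟨0̂, q ]?) * Y r (ρ q))))
        ≡⟨ sum-cong-≗ (λ r → sum-cong-≗ (λ q → regroup r q)) ⟩
      sum (λ r → sum (λ q → 𝟙 (r ∈⟨0̂, p ]?) * (𝟙 (r ⊑? q) * (𝟙 (q ⊑? p) * Y r (ρ q)))))
        ≡⟨ sum-cong-≗ (λ r → *-distribˡ-sum (𝟙 (r ∈⟨0̂, p ]?)) (λ q → 𝟙 (r ⊑? q) * (𝟙 (q ⊑? p) * Y r (ρ q)))) ⟨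
      ∑₊ p (λ r → sum (λ q → 𝟙 (r ⊑? q) * (𝟙 (q ⊑? p) * Y r (ρ q))))
        ≡⟨ ∑₊-cong p (λ r r≢0̂ r⊑p → BooleanInterval.sum-interval P (dualSimplicial r r≢0̂) r⊑p (Y r)) ⟩
      ∑₊ p (λ r → Cube (ρ p ∸ ρ r) (λ s → Y r (ρ r ℕ.+ s))) ∎
      where
      regroup : ∀ r q → 𝟙 (q ∈⟨0̂, p ]?) * (𝟙 (r ∈⟨0̂, q ]?) * Y r (ρ q)) ≡
                        𝟙 (r ∈⟨0̂, p ]?) * (𝟙 (r ⊑? q) * (𝟙 (q ⊑? p) * Y r (ρ q)))
      regroup r q = begin
        𝟙 (q ∈⟨0̂, p ]?) * (𝟙 (r ∈⟨0̂, q ]?) * y)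
          ≡⟨ 𝟙-× (q ∈⟨0̂, p ]?) (r ∈⟨0̂, q ]?) y ⟩
        𝟙 ((q ∈⟨0̂, p ]?) ×-dec (r ∈⟨0̂, q ]?)) * y
          ≡⟨ cong (λ e → e * y) (𝟙-cong ((q ∈⟨0̂, p ]?) ×-dec (r ∈⟨0̂, q ]?)) ((r ∈⟨0̂, p ]?) ×-dec ((r ⊑? q) ×-dec (q ⊑? p)))
               (λ ((_ , q⊑p) , (r≢0̂ , r⊑q)) → (r≢0̂ , ⊑-trans r⊑q q⊑p) , (r⊑q , q⊑p))
               (λ ((r≢0̂ , _) , (r⊑q , q⊑p)) → ((λ { refl → r≢0̂ (⊑-antisym r⊑q (0̂-minimum r)) }) , q⊑p) , (r≢0̂ , r⊑q))) ⟩
        𝟙 ((r ∈⟨0̂, p ]?) ×-dec ((r ⊑? q) ×-dec (q ⊑? p))) * y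
          ≡⟨ 𝟙-× (r ∈⟨0̂, p ]?) ((r ⊑? q) ×-dec (q ⊑? p)) y ⟨
        𝟙 (r ∈⟨0̂, p ]?) * (𝟙 ((r ⊑? q) ×-dec (q ⊑? p)) * y)
          ≡⟨ cong (𝟙 (r ∈⟨0̂, p ]?) *_) (𝟙-× (r ⊑? q) (q ⊑? p) y) ⟨
        𝟙 (r ∈⟨0̂, p ]?) * (𝟙 (r ⊑? q) * (𝟙 (q ⊑? p) * y)) ∎
        where y = Y r (ρ q)

    c-∸ : ∀ {k m} → k ℕ.≤ m → δ^ (m ∸ k) · c k ≡ c m
    c-∸ {k} {m} k≤m = trans (sym (fold-+ one δ_ (m ∸ k))) (cong c (ℕₚ.m∸n+n≡m k≤m))

    -- The Dehn–Sommerville relations.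
    rev-D : ∀ p → rev (ρ p) (D p) ≗ λ i → - D p i
    rev-D p i = begin
      rev (ρ p) (D p) i
        ≡⟨ ∑₊-linear (rev-linear (ρ p)) p (λ q → c (ρ q)) i ⟩
      ∑₊ p (λ q → rev (ρ p) (c (ρ q)) i)
        ≡⟨ ∑₊-cong p (λ q _ q⊑p → rev-shift q q⊑p) ⟩
      ∑₊ p (λ q → sgn (ρ q) * (x^ (ρ p ∸ ρ q) · c (ρ q)) i)
        -- x^{ρ(p) - ρ(q)} is expanded into the sum of (x - 1)^{ρ(r) - ρ(q)} over q ≤ r ≤ p. After
        -- the exchange each term is (-1)^{ρ(q)} (x - 1)^{ρ(r)}, and by `euler` the signs over (0̂,
        -- r] sum to -1.
        ≡⟨ ∑₊-cong p (λ q _ _ → trans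
             (cong (sgn (ρ q) *_) (trans (sym (Cube-δ (ρ p ∸ ρ q) (c (ρ q)) i))
               (Cube-cong (ρ p ∸ ρ q) λ s _ → cong (λ m → (δ^ m · c (ρ q)) i) (sym (ℕₚ.m+n∸m≡n (ρ q) s)))))
             (sym (Cube-* (ρ p ∸ ρ q) (sgn (ρ q)) _))) ⟩
      ∑₊ p (λ q → Cube (ρ p ∸ ρ q) (λ s → Y q (ρ q ℕ.+ s)))
        ≡⟨ ∑₊-exchange p Y ⟨
      ∑₊ p (λ r → ∑₊ r (λ q → Y q (ρ r)))
        ≡⟨ ∑₊-cong p (λ r r≢0̂ _ → begin
             ∑₊ r (λ q → Y q (ρ r))              ≡⟨ ∑₊-cong r (λ q _ q⊑r → cong (λ u → sgn (ρ q) * u i) (c-∸ (ρ-mono q⊑r))) ⟩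
             ∑₊ r (λ q → sgn (ρ q) * c (ρ r) i)  ≡⟨ ∑₊-*ʳ r (sgn ∘ ρ) (c (ρ r) i) ⟩
             ∑₊ r (sgn ∘ ρ) * c (ρ r) i          ≡⟨ cong (λ e → e * c (ρ r) i) (euler r r≢0̂) ⟩
             -1ℤ * c (ρ r) i                     ∎) ⟩
      ∑₊ p (λ r → -1ℤ * c (ρ r) i)
        ≡⟨ ∑₊-* p -1ℤ (λ r → c (ρ r) i) ⟩
      -1ℤ * D p i
        ≡⟨ ℤₚ.-1*i≡-i (D p i) ⟩
      - D p i ∎
      where
      Y : Fin size → ℕ → ℤ
      Y q t = sgn (ρ q) * (δ^ (t ∸ ρ q) · c (ρ q)) i
      rev-shift : ∀ q → q ⊑ p → rev (ρ p) (c (ρ q)) i ≡ sgn (ρ q) * (x^ (ρ p ∸ ρ q) · c (ρ q)) i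
      rev-shift q q⊑p = begin
        rev (ρ p) (c (ρ q)) i
          ≡⟨ cong (λ N → rev N (c (ρ q)) i) (ℕₚ.m∸n+n≡m (ρ-mono q⊑p)) ⟨
        rev (ρ p ∸ ρ q ℕ.+ ρ q) (c (ρ q)) i
          ≡⟨ rev-+ (ρ p ∸ ρ q) (c-degree (ρ q)) i ⟩
        (x^ (ρ p ∸ ρ q) · rev (ρ q) (c (ρ q))) i
          ≡⟨ x^-linear .≗-cong (rev-c (ρ q)) i ⟩
        (x^ (ρ p ∸ ρ q) · (λ i → sgn (ρ q) * c (ρ q) i)) i
          ≡⟨ x^-linear .*-homo (sgn (ρ q)) (c (ρ q)) i ⟩
        sgn (ρ q) * (x^ (ρ p ∸ ρ q) · c (ρ q)) i ∎
        where x^-linear = fold-linear x·-linear (ρ p ∸ ρ q)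

    -- The summand of r ∈ (0̂, p] in g[0̂, p ⟩: up to a sign, the truncation of (1 - x)h(r)
    -- to degrees below ρ r / 2, where D r = (x - 1)h(r).
    B : Fin size → Series
    B r i = sgn (ρ r) * truncate (ρ r) (D r) i

    rev-B : ∀ r i → rev (ρ r) (B r) i + sgn (ρ r) * D r i ≡ B r i
    rev-B r i = begin
      rev (ρ r) (B r) i + sgn (ρ r) * D r i
        ≡⟨ cong (_+ sgn (ρ r) * D r i) (rev-linear (ρ r) .*-homo (sgn (ρ r)) (truncate (ρ r) (D r)) i) ⟩
      sgn (ρ r) * rev (ρ r) (truncate (ρ r) (D r)) i + sgn (ρ r) * D r i
        ≡⟨ ℤₚ.*-distribˡ-+ (sgn (ρ r)) (rev (ρ r) (truncate (ρ r) (D r)) i) (D r i) ⟨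
      sgn (ρ r) * (rev (ρ r) (truncate (ρ r) (D r)) i + D r i)
        ≡⟨ cong (sgn (ρ r) *_) (rev-truncate (D-degree r) (rev-D r) i) ⟩
      B r i ∎

    B-degree : ∀ r → Degree≤ (ρ r) (B r)
    B-degree r i ρr<i = trans
      (cong (λ d → sgn (ρ r) * (𝟙 (i ℕ.+ i ℕₚ.<? ρ r) * d)) (D-degree r i ρr<i))
      (trans (cong (sgn (ρ r) *_) (ℤₚ.*-zeroʳ (𝟙 (i ℕ.+ i ℕₚ.<? ρ r)))) (ℤₚ.*-zeroʳ (sgn (ρ r))))

    ∑B : Fin size → Series
    ∑B p i = ∑₊ p (λ r → B r i)

    ∑B-truncated : ∀ p i → ρ p ℕ.≤ i ℕ.+ i → ∑B p i ≡ 0ℤ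
    ∑B-truncated p i ρp≤2i = trans
      (∑₊-cong p λ r _ r⊑p → trans
        (cong (λ e → sgn (ρ r) * (e * D r i))
          (𝟙-no (i ℕ.+ i ℕₚ.<? ρ r) (ℕₚ.≤⇒≯ (ℕₚ.≤-trans (ρ-mono r⊑p) ρp≤2i))))
        (ℤₚ.*-zeroʳ (sgn (ρ r))))
      (∑₊-0 p)

    -- For fixed r the powers (x - 1)^{ρ(p) - ρ(q)} over q in [r, p] add up to x^{ρ(p) - ρ(r)}.
    ∑B-x^ : ∀ p i → ∑₊ p (λ q → (δ^ (ρ p ∸ ρ q) · ∑B q) i) ≡ ∑₊ p (λ r → (x^ (ρ p ∸ ρ r) · B r) i)
    ∑B-x^ p i = begin
      ∑₊ p (λ q → (δ^ (ρ p ∸ ρ q) · ∑B q) i)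
        ≡⟨ ∑₊-cong p (λ q _ _ → ∑₊-linear (fold-linear δ-linear (ρ p ∸ ρ q)) q B i) ⟩
      ∑₊ p (λ q → ∑₊ q (λ r → (δ^ (ρ p ∸ ρ q) · B r) i))
        ≡⟨ ∑₊-exchange p (λ r t → (δ^ (ρ p ∸ t) · B r) i) ⟩
      ∑₊ p (λ r → Cube (ρ p ∸ ρ r) (λ s → (δ^ (ρ p ∸ (ρ r ℕ.+ s)) · B r) i))
        ≡⟨ ∑₊-cong p (λ r _ _ → trans
             (Cube-cong (ρ p ∸ ρ r) λ s _ → cong (λ m → (δ^ m · B r) i) (sym (ℕₚ.∸-+-assoc (ρ p) (ρ r) s)))
             (Cube-δ-∸ (ρ p ∸ ρ r) (B r) i)) ⟩
      ∑₊ p (λ r → (x^ (ρ p ∸ ρ r) · B r) i) ∎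

    -- Once D(r) is expanded and the sums are exchanged, the signed powers of x over [q, p] give
    -- (-1)^{ρ(q)} (x - 1)^{ρ(p) - ρ(q)}, which completes (x - 1)^{ρ(q)} to (x - 1)^{ρ(p)}
    -- independently of q. Only the Euler sum of the signs remains.
    ∑D-x^ : ∀ p → p ≢ 0̂ → ∀ i → ∑₊ p (λ r → sgn (ρ r) * (x^ (ρ p ∸ ρ r) · D r) i) ≡ - c (ρ p) i
    ∑D-x^ p p≢0̂ i = begin
      ∑₊ p (λ r → sgn (ρ r) * (x^ (ρ p ∸ ρ r) · D r) i)
        ≡⟨ ∑₊-cong p (λ r _ _ → trans
             (cong (sgn (ρ r) *_) (∑₊-linear (fold-linear x·-linear (ρ p ∸ ρ r)) r (c ∘ ρ) i))
             (sym (∑₊-* r (sgn (ρ r)) (λ q → (x^ (ρ p ∸ ρ r) · c (ρ q)) i)))) ⟩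
      ∑₊ p (λ r → ∑₊ r (λ q → Y q (ρ r)))
        ≡⟨ ∑₊-exchange p Y ⟩
      ∑₊ p (λ q → Cube (ρ p ∸ ρ q) (λ s → Y q (ρ q ℕ.+ s)))
        ≡⟨ ∑₊-cong p (λ q _ q⊑p → inner q q⊑p) ⟩
      ∑₊ p (λ q → sgn (ρ q) * c (ρ p) i)
        ≡⟨ ∑₊-*ʳ p (sgn ∘ ρ) (c (ρ p) i) ⟩
      ∑₊ p (sgn ∘ ρ) * c (ρ p) i
        ≡⟨ cong (λ e → e * c (ρ p) i) (euler p p≢0̂) ⟩
      -1ℤ * c (ρ p) i
        ≡⟨ ℤₚ.-1*i≡-i (c (ρ p) i) ⟩
      - c (ρ p) i ∎
      where
      Y : Fin size → ℕ → ℤ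
      Y q t = sgn t * (x^ (ρ p ∸ t) · c (ρ q)) i
      inner : ∀ q → q ⊑ p → Cube (ρ p ∸ ρ q) (λ s → Y q (ρ q ℕ.+ s)) ≡ sgn (ρ q) * c (ρ p) i
      inner q q⊑p = begin
        Cube M (λ s → sgn (ρ q ℕ.+ s) * (x^ (ρ p ∸ (ρ q ℕ.+ s)) · c (ρ q)) i)
          ≡⟨ Cube-cong M (λ s _ → trans
               (cong₂ (λ e m → e * (x^ m · c (ρ q)) i) (sgn-+ (ρ q) s) (sym (ℕₚ.∸-+-assoc (ρ p) (ρ q) s)))
               (ℤₚ.*-assoc (sgn (ρ q)) (sgn s) _)) ⟩
        Cube M (λ s → sgn (ρ q) * (sgn s * (x^ (M ∸ s) · c (ρ q)) i))
          ≡⟨ Cube-* M (sgn (ρ q)) (λ s → sgn s * (x^ (M ∸ s) · c (ρ q)) i) ⟩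
        sgn (ρ q) * Cube M (λ s → sgn s * (x^ (M ∸ s) · c (ρ q)) i)
          ≡⟨ cong (sgn (ρ q) *_) (Cube-x-∸ M (c (ρ q)) i) ⟩
        sgn (ρ q) * (δ^ M · c (ρ q)) i
          ≡⟨ cong (λ u → sgn (ρ q) * u i) (c-∸ (ρ-mono q⊑p)) ⟩
        sgn (ρ q) * c (ρ p) i ∎
        where M = ρ p ∸ ρ q

    -- The term `c (ρ p)` is the contribution of q = 0̂ to the reciprocity; `∑D-x^` cancels it.
    rev-∑B : ∀ p → p ≢ 0̂ → ∀ i → c (ρ p) i + ∑₊ p (λ q → (δ^ (ρ p ∸ ρ q) · ∑B q) i) ≡ rev (ρ p) (∑B p) i
    rev-∑B p p≢0̂ i = begin
      c (ρ p) i + ∑₊ p (λ q → (δ^ (ρ p ∸ ρ q) · ∑B q) i)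
        ≡⟨ cong (c (ρ p) i +_) (∑B-x^ p i) ⟩
      c (ρ p) i + ∑₊ p (λ r → (x^ (ρ p ∸ ρ r) · B r) i)
        ≡⟨ cong (c (ρ p) i +_) (∑₊-cong p λ r _ r⊑p → split r r⊑p) ⟩
      c (ρ p) i + ∑₊ p (λ r → rev (ρ p) (B r) i + sgn (ρ r) * (x^ (ρ p ∸ ρ r) · D r) i)
        ≡⟨ cong (c (ρ p) i +_) (∑₊-+ p (λ r → rev (ρ p) (B r) i) (λ r → sgn (ρ r) * (x^ (ρ p ∸ ρ r) · D r) i)) ⟩
      c (ρ p) i + (∑₊ p (λ r → rev (ρ p) (B r) i) + ∑₊ p (λ r → sgn (ρ r) * (x^ (ρ p ∸ ρ r) · D r) i))
        ≡⟨ cong₂ (λ a b → c (ρ p) i + (a + b)) (sym (∑₊-linear (rev-linear (ρ p)) p B i)) (∑D-x^ p p≢0̂ i) ⟩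
      c (ρ p) i + (rev (ρ p) (∑B p) i - c (ρ p) i)
        ≡⟨ cancel (c (ρ p) i) (rev (ρ p) (∑B p) i) ⟩
      rev (ρ p) (∑B p) i ∎
      where
      cancel : ∀ a b → a + (b - a) ≡ b
      cancel = solve-∀
      split : ∀ r → r ⊑ p → (x^ (ρ p ∸ ρ r) · B r) i ≡ rev (ρ p) (B r) i + sgn (ρ r) * (x^ (ρ p ∸ ρ r) · D r) i
      split r r⊑p = begin
        (x^ (ρ p ∸ ρ r) · B r) i
          ≡⟨ x^-linear .≗-cong (λ i → sym (rev-B r i)) i ⟩
        (x^ (ρ p ∸ ρ r) · (λ i → rev (ρ r) (B r) i + sgn (ρ r) * D r i)) i
          ≡⟨ x^-linear .+-homo (rev (ρ r) (B r)) (λ i → sgn (ρ r) * D r i) i ⟩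
        (x^ (ρ p ∸ ρ r) · rev (ρ r) (B r)) i + (x^ (ρ p ∸ ρ r) · (λ i → sgn (ρ r) * D r i)) i
          ≡⟨ cong₂ _+_
               (trans (sym (rev-+ (ρ p ∸ ρ r) (B-degree r) i))
                      (cong (λ N → rev N (B r) i) (ℕₚ.m∸n+n≡m (ρ-mono r⊑p))))
               (x^-linear .*-homo (sgn (ρ r)) (D r) i) ⟩
        rev (ρ p) (B r) i + sgn (ρ r) * (x^ (ρ p ∸ ρ r) · D r) i ∎
        where x^-linear = fold-linear x·-linear (ρ p ∸ ρ r)

    -- After the exchange, q enters through its j-th coefficient and a cube whose dimension depends
    -- on ρ(q). `antidiagonal-c` trades this for all coefficients of (x - 1)^{ρ(q)}, with weights
    -- `G i k` independent of q, so the sum over q can be taken inside and yields `D p`.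
    ∑B-antidiagonal : ∀ p j → ∑B p j ≡ Antidiagonal (ρ p) (λ i k → D p i * (binom i j * (-1ℤ * pos (predBinom k j))))
    ∑B-antidiagonal p j = begin
      ∑₊ p (λ r → sgn (ρ r) * (𝟙 (j ℕ.+ j ℕₚ.<? ρ r) * ∑₊ r (λ q → c (ρ q) j)))
        ≡⟨ ∑₊-cong p (λ r _ _ → trans
             (regroup (sgn (ρ r)) (𝟙 (j ℕ.+ j ℕₚ.<? ρ r)) (D r j))
             (sym (∑₊-*ʳ r (λ q → c (ρ q) j) (signedTail j (ρ r))))) ⟩
      ∑₊ p (λ r → ∑₊ r (λ q → Y q (ρ r)))
        ≡⟨ ∑₊-exchange p Y ⟩
      ∑₊ p (λ q → Cube (ρ p ∸ ρ q) (λ s → Y q (ρ q ℕ.+ s)))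
        ≡⟨ ∑₊-cong p (λ q _ q⊑p → inner q q⊑p) ⟩
      ∑₊ p (λ q → Antidiagonal (ρ p) (λ i k → c (ρ q) i * G i k))
        ≡⟨ ∑₊-antidiagonal p (ρ p) (λ q i k → c (ρ q) i * G i k) ⟩
      Antidiagonal (ρ p) (λ i k → ∑₊ p (λ q → c (ρ q) i * G i k))
        ≡⟨ antidiagonal-cong (ρ p) (λ i k _ → trans
             (∑₊-*ʳ p (λ q → c (ρ q) i) (G i k))
             (cong (λ e → D p i * (binom i j * e)) (Cube-signedTail k j))) ⟩
      Antidiagonal (ρ p) (λ i k → D p i * (binom i j * (-1ℤ * pos (predBinom k j)))) ∎
      where
      Y : Fin size → ℕ → ℤ
      Y q t = c (ρ q) j * signedTail j t
      G : ℕ → ℕ → ℤ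
      G i k = binom i j * Cube k (λ s → signedTail j (j ℕ.+ s))
      regroup : ∀ a b d → a * (b * d) ≡ d * (a * b)
      regroup = solve-∀
      inner : ∀ q → q ⊑ p → Cube (ρ p ∸ ρ q) (λ s → Y q (ρ q ℕ.+ s)) ≡ Antidiagonal (ρ p) (λ i k → c (ρ q) i * G i k)
      inner q q⊑p = begin
        Cube (ρ p ∸ ρ q) (λ s → c (ρ q) j * signedTail j (ρ q ℕ.+ s))
          ≡⟨ Cube-* (ρ p ∸ ρ q) (c (ρ q) j) (λ s → signedTail j (ρ q ℕ.+ s)) ⟩
        c (ρ q) j * Cube (ρ p ∸ ρ q) (λ s → signedTail j (ρ q ℕ.+ s))
          ≡⟨ antidiagonal-c (ρ q) (ρ p ∸ ρ q) j (signedTail j) ⟨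
        Antidiagonal (ρ q ℕ.+ (ρ p ∸ ρ q)) (λ i k → c (ρ q) i * G i k)
          ≡⟨ cong (λ N → Antidiagonal N (λ i k → c (ρ q) i * G i k)) (ℕₚ.m+[n∸m]≡n (ρ-mono q⊑p)) ⟩
        Antidiagonal (ρ p) (λ i k → c (ρ q) i * G i k) ∎

    D-antisymmetric : ∀ p i k → i ℕ.+ k ≡ ρ p → D p k ≡ - D p i
    D-antisymmetric p i k i+k≡ρp = begin
      D p k               ≡⟨ cong (D p) (ℕₚ.m+n∸m≡n i k) ⟨
      D p (i ℕ.+ k ∸ i)   ≡⟨ cong (λ N → D p (N ∸ i)) i+k≡ρp ⟩
      D p (ρ p ∸ i)       ≡⟨ rev-≤ (D p) (subst (i ℕ.≤_) i+k≡ρp (ℕₚ.m≤m+n i k)) ⟨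
      rev (ρ p) (D p) i   ≡⟨ rev-D p i ⟩
      - D p i             ∎

    D-zero : ∀ p → p ≢ 0̂ → D p zero ≡ -1ℤ
    D-zero p p≢0̂ = trans (∑₊-cong p (λ q _ _ → c-zero (ρ q))) (euler p p≢0̂)
      where
      c-zero : ∀ k → c k zero ≡ sgn k
      c-zero zero    = refl
      c-zero (suc k) = trans (cong (λ a → 0ℤ - a) (c-zero k)) (negate (sgn k))
        where
        negate : ∀ a → 0ℤ - a ≡ -1ℤ * a
        negate = solve-∀

-- Coefficients of polynomials

coeff-⊕ : ∀ p q i → coeff (p ⊕ q) i ≡ coeff p i + coeff q i
coeff-⊕ []      q       i       = sym (ℤₚ.+-identityˡ (coeff q i))
coeff-⊕ (a ∷ p) []      i       = sym (ℤₚ.+-identityʳ (coeff (a ∷ p) i))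
coeff-⊕ (a ∷ p) (b ∷ q) zero    = refl
coeff-⊕ (a ∷ p) (b ∷ q) (suc i) = coeff-⊕ p q i

coeff-map : ∀ a p i → coeff (List.map (a *_) p) i ≡ a * coeff p i
coeff-map a []      i       = sym (ℤₚ.*-zeroʳ a)
coeff-map a (b ∷ p) zero    = refl
coeff-map a (b ∷ p) (suc i) = coeff-map a p i

coeff-0∷ : ∀ p → coeff (0ℤ ∷ p) ≗ x· coeff p
coeff-0∷ p zero    = refl
coeff-0∷ p (suc i) = refl

coeff-∷⊗ : ∀ a p q → coeff ((a ∷ p) ⊗ q) ≗ λ i → a * coeff q i + (x· coeff (p ⊗ q)) i
coeff-∷⊗ a p q i = trans
  (coeff-⊕ (List.map (a *_) q) (0ℤ ∷ p ⊗ q) i)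
  (cong₂ _+_ (coeff-map a q i) (coeff-0∷ (p ⊗ q) i))

coeff-x-1⊗ : ∀ q → coeff (x-1 ⊗ q) ≗ δ coeff q
coeff-x-1⊗ q i = begin
  coeff (x-1 ⊗ q) i
    ≡⟨ coeff-∷⊗ -1ℤ (1ℤ ∷ []) q i ⟩
  -1ℤ * coeff q i + (x· coeff ((1ℤ ∷ []) ⊗ q)) i
    ≡⟨ cong (-1ℤ * coeff q i +_) (x·-linear .≗-cong coeff-1⊗ i) ⟩
  -1ℤ * coeff q i + (x· coeff q) i
    ≡⟨ swap (coeff q i) ((x· coeff q) i) ⟩
  (δ coeff q) i ∎
  where
  coeff-x·[] : x· coeff [] ≗ λ _ → 0ℤ
  coeff-x·[] zero    = refl
  coeff-x·[] (suc i) = refl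
  coeff-1⊗ : coeff ((1ℤ ∷ []) ⊗ q) ≗ coeff q
  coeff-1⊗ i = trans (coeff-∷⊗ 1ℤ [] q i)
    (trans (cong₂ _+_ (ℤₚ.*-identityˡ (coeff q i)) (coeff-x·[] i)) (ℤₚ.+-identityʳ (coeff q i)))
  swap : ∀ a b → -1ℤ * a + b ≡ b - a
  swap = solve-∀

coeff-⊗x-1⊗ : ∀ p q → coeff (p ⊗ (x-1 ⊗ q)) ≗ δ coeff (p ⊗ q)
coeff-⊗x-1⊗ []      q zero    = refl
coeff-⊗x-1⊗ []      q (suc i) = refl
coeff-⊗x-1⊗ (a ∷ p) q i = begin
  coeff ((a ∷ p) ⊗ (x-1 ⊗ q)) i
    ≡⟨ coeff-∷⊗ a p (x-1 ⊗ q) i ⟩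
  a * coeff (x-1 ⊗ q) i + (x· coeff (p ⊗ (x-1 ⊗ q))) i
    ≡⟨ cong₂ (λ u v → a * u + v) (coeff-x-1⊗ q i) (trans (x·-linear .≗-cong (coeff-⊗x-1⊗ p q) i) (x·-δ (coeff (p ⊗ q)) i)) ⟩
  a * (δ coeff q) i + (δ x· coeff (p ⊗ q)) i
    ≡⟨ cong (_+ (δ x· coeff (p ⊗ q)) i) (δ-linear .*-homo a (coeff q) i) ⟨
  (δ (λ i → a * coeff q i)) i + (δ x· coeff (p ⊗ q)) i
    ≡⟨ δ-linear .+-homo (λ i → a * coeff q i) (x· coeff (p ⊗ q)) i ⟨
  (δ (λ i → a * coeff q i + (x· coeff (p ⊗ q)) i)) i
    ≡⟨ δ-linear .≗-cong (coeff-∷⊗ a p q) i ⟨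
  (δ coeff ((a ∷ p) ⊗ q)) i ∎
  where
  x·-δ : ∀ u → x· δ u ≗ δ x· u
  x·-δ u zero    = refl
  x·-δ u (suc i) = refl

coeff-⊗1ₚ : ∀ p → coeff (p ⊗ 1ₚ) ≗ coeff p
coeff-⊗1ₚ []      i       = refl
coeff-⊗1ₚ (a ∷ p) zero    = trans (ℤₚ.+-identityʳ (a * 1ℤ)) (ℤₚ.*-identityʳ a)
coeff-⊗1ₚ (a ∷ p) (suc i) = coeff-⊗1ₚ p i

coeff-⊗x-1^ : ∀ p k → coeff (p ⊗ x-1 ⊗^ k) ≗ δ^ k · coeff p
coeff-⊗x-1^ p zero    i = coeff-⊗1ₚ p i
coeff-⊗x-1^ p (suc k) i = trans (coeff-⊗x-1⊗ p (x-1 ⊗^ k) i) (δ-linear .≗-cong (coeff-⊗x-1^ p k) i)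

coeff-∑ₚ : ∀ {A : Set} (f : A → Poly) {n} (h : Fin n → A) i →
  coeff (∑ₚ (List.map f (List.tabulate h))) i ≡ sum (λ r → coeff (f (h r)) i)
coeff-∑ₚ f {zero}  h i = refl
coeff-∑ₚ f {suc n} h i = trans
  (coeff-⊕ (f (h zero)) _ i)
  (cong (coeff (f (h zero)) i +_) (coeff-∑ₚ f (h ∘ suc) i))

coeff-applyUpTo-< : ∀ (f : ℕ → ℤ) {n i} → i <ℕ n → coeff (List.applyUpTo f n) i ≡ f i
coeff-applyUpTo-< f {suc n} {zero}  _           = refl
coeff-applyUpTo-< f {suc n} {suc i} (ℕ.s≤s i<n) = coeff-applyUpTo-< (f ∘ suc) i<n

coeff-applyUpTo-≥ : ∀ (f : ℕ → ℤ) {n i} → n ℕ.≤ i → coeff (List.applyUpTo f n) i ≡ 0ℤ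
coeff-applyUpTo-≥ f {zero}              _           = refl
coeff-applyUpTo-≥ f {suc n} {suc i} (ℕ.s≤s n≤i) = coeff-applyUpTo-≥ (f ∘ suc) n≤i

coeff-gFrom-≤ : ∀ r f {i} → i ℕ.≤ ⌊ r /2⌋ → coeff (gFrom (suc r) f) i ≡ - (δ coeff f) i
coeff-gFrom-≤ r f {zero}  _   = zero-minus (coeff f zero)
  where
  zero-minus : ∀ a → a ≡ - (0ℤ - a)
  zero-minus = solve-∀
coeff-gFrom-≤ r f {suc i} i<r/2 = trans
  (coeff-applyUpTo-< _ i<r/2)
  (swap (coeff f i) (coeff f (suc i)))
  where
  swap : ∀ a b → b - a ≡ - (a - b)
  swap = solve-∀

coeff-gFrom-> : ∀ r f {i} → ⌊ r /2⌋ <ℕ i → coeff (gFrom (suc r) f) i ≡ 0ℤ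
coeff-gFrom-> r f {suc i} (ℕ.s≤s r/2≤i) = coeff-applyUpTo-≥ _ r/2≤i

coeff-when : ∀ {A : Set} (d : Dec A) {p : Poly} i {y} → coeff p i ≡ y → coeff (when d (λ _ → p)) i ≡ 𝟙 d * y
coeff-when (yes _) i eq = trans eq (sym (ℤₚ.*-identityˡ _))
coeff-when (no _)  i eq = refl

coeff-1ₚ : coeff 1ₚ ≗ one
coeff-1ₚ zero    = refl
coeff-1ₚ (suc i) = refl

-- Characterisation of g by reciprocity and a degree bound

module ToricCoefficients (P : GradedPoset) where
  open GradedPoset P
  open Toric P
  open IsPartialOrder isPartialOrder using () renaming (refl to ⊑-refl)

  coeff-fFrom : ∀ r p i → coeff (fFrom (suc r) p (λ {q} _ → g[0̂, q ⟩)) i ≡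
    sum (λ q → 𝟙 (q ⊏? p) * (δ^ (r ∸ ρ q) · coeff g[0̂, q ⟩) i)
  coeff-fFrom r p i = trans
    (coeff-∑ₚ (λ q → when (q ⊏? p) _) id i)
    (sum-cong-≗ λ q → coeff-when (q ⊏? p) i (coeff-⊗x-1^ g[0̂, q ⟩ (r ∸ ρ q) i))

  coeff-f[0̂,1̂] : ∀ i → coeff f[0̂,1̂] i ≡ sum (λ p → (δ^ (rank ∸ ρ p) · coeff g[0̂, p ⟩) i)
  coeff-f[0̂,1̂] i = trans
    (coeff-∑ₚ (λ p → g[0̂, p ⟩ ⊗ x-1 ⊗^ (rank ∸ ρ p)) id i)
    (sum-cong-≗ λ p → coeff-⊗x-1^ g[0̂, p ⟩ (rank ∸ ρ p) i)

  sum-⊑-top : ∀ p (f : Fin size → ℤ) → sum (λ q → 𝟙 (q ⊑? p) * f q) ≡ sum (λ q → 𝟙 (q ⊏? p) * f q) + f p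
  sum-⊑-top p f = begin
    sum (λ q → 𝟙 (q ⊑? p) * f q)
      ≡⟨ sum-cong-≗ split ⟩
    sum (λ q → 𝟙 (q ⊏? p) * f q + 𝟙 (q ≟ p) * f q)
      ≡⟨ ∑-distrib-+ (λ q → 𝟙 (q ⊏? p) * f q) (λ q → 𝟙 (q ≟ p) * f q) ⟩
    S + sum (λ q → 𝟙 (q ≟ p) * f q)
      ≡⟨ cong (S +_) (sum-single p λ q q≢p → cong (λ e → e * f q) (𝟙-no (q ≟ p) q≢p)) ⟩
    S + 𝟙 (p ≟ p) * f p
      ≡⟨ cong (λ e → S + e * f p) (𝟙-yes (p ≟ p) refl) ⟩
    S + 1ℤ * f p
      ≡⟨ cong (S +_) (ℤₚ.*-identityˡ (f p)) ⟩
    S + f p ∎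
    where
    S = sum (λ q → 𝟙 (q ⊏? p) * f q)
    split : ∀ q → 𝟙 (q ⊑? p) * f q ≡ 𝟙 (q ⊏? p) * f q + 𝟙 (q ≟ p) * f q
    split q = trans (cong (λ e → e * f q) indicator) (ℤₚ.*-distribʳ-+ (f q) (𝟙 (q ⊏? p)) (𝟙 (q ≟ p)))
      where
      indicator : 𝟙 (q ⊑? p) ≡ 𝟙 (q ⊏? p) + 𝟙 (q ≟ p)
      indicator = case q ≟ p of λ where
        (yes refl) → trans (𝟙-yes (q ⊑? q) ⊑-refl)
          (sym (cong₂ _+_ (𝟙-no (q ⊏? q) λ (_ , q≢q) → q≢q refl) (𝟙-yes (q ≟ q) refl)))
        (no q≢p) → trans (𝟙-cong (q ⊑? p) (q ⊏? p) (_, q≢p) proj₁)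
          (sym (trans (cong (𝟙 (q ⊏? p) +_) (𝟙-no (q ≟ p) q≢p)) (ℤₚ.+-identityʳ (𝟙 (q ⊏? p)))))

  -- Splitting off q = p, the reciprocity hypothesis says (x - 1)f[0̂, p ⟩ + a p = rev (ρ p) (a p).
  -- Its right-hand side vanishes in degrees below ρ p / 2, so there a p = (1 - x)f[0̂, p ⟩.
  g-unique : (Q : Fin size → Set) → (∀ {q p} → q ⊑ p → Q p → Q q) → (a : Fin size → Series) →
    a 0̂ ≗ one →
    (∀ p → Q p → p ≢ 0̂ → ∀ i → ρ p ℕ.≤ i ℕ.+ i → a p i ≡ 0ℤ) →
    (∀ p → Q p → p ≢ 0̂ → ∀ i → sum (λ q → 𝟙 (q ⊑? p) * (δ^ (ρ p ∸ ρ q) · a q) i) ≡ rev (ρ p) (a p) i) →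
    ∀ p → Q p → coeff g[0̂, p ⟩ ≗ a p
  g-unique Q Q-down a a-0̂ a-degree a-rev p = go p (⊏-wellFounded p)
    where
    go : ∀ p → Acc _⊏_ p → Q p → coeff g[0̂, p ⟩ ≗ a p
    step : ∀ p → (∀ {q} → q ⊏ p → Q q → coeff g[0̂, q ⟩ ≗ a q) → Q p → p ≢ 0̂ → ∀ r → ρ p ≡ suc r →
      coeff (gFrom (suc r) (fFrom (suc r) p (λ {q} _ → g[0̂, q ⟩))) ≗ a p

    go p (acc below) Qp i = case p ≟ 0̂ of λ where
        (yes p≡0̂) → subst (λ p → coeff g[0̂, p ⟩ i ≡ a p i) (sym p≡0̂) base
        (no p≢0̂)  → positive p≢0̂ (ρ p) refl
      where
      base : coeff g[0̂, 0̂ ⟩ i ≡ a 0̂ i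
      base = begin
        coeff g[0̂, 0̂ ⟩ i                ≡⟨ cong (λ g → coeff g i) (g-unfold 0̂) ⟩
        coeff (gFrom (ρ 0̂) f[0̂, 0̂ ⟩) i   ≡⟨ cong (λ r → coeff (gFrom r f[0̂, 0̂ ⟩) i) ρ-0̂ ⟩
        coeff 1ₚ i                      ≡⟨ coeff-1ₚ i ⟩
        one i                           ≡⟨ a-0̂ i ⟨
        a 0̂ i                           ∎
      -- The rank is abstracted to r because `gFrom` and `fFrom` reduce only when it is a
      -- constructor.
      positive : p ≢ 0̂ → ∀ r → ρ p ≡ r → coeff g[0̂, p ⟩ i ≡ a p i
      positive p≢0̂ zero ρp≡0 = contradiction
        (subst₂ _<ℕ_ ρ-0̂ ρp≡0 (ρ-mono-⊏ (0̂-minimum p , p≢0̂ ∘ sym))) λ ()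
      positive p≢0̂ (suc r) ρp≡1+r = begin
        coeff g[0̂, p ⟩ i
          ≡⟨ cong (λ g → coeff g i) (g-unfold p) ⟩
        coeff (gFrom (ρ p) (fFrom (ρ p) p (λ {q} _ → g[0̂, q ⟩))) i
          ≡⟨ cong (λ r → coeff (gFrom r (fFrom r p (λ {q} _ → g[0̂, q ⟩))) i) ρp≡1+r ⟩
        coeff (gFrom (suc r) (fFrom (suc r) p (λ {q} _ → g[0̂, q ⟩))) i
          ≡⟨ step p (λ {q} q⊏p → go q (below q⊏p)) Qp p≢0̂ r ρp≡1+r i ⟩
        a p i ∎

    -- As ρ(p) = r + 1, the cut-off i ≤ ⌊r/2⌋ of `gFrom` is the condition 2i < ρ(p), exactly
    -- complementary to the range where `a-degree` gives 0.
    step p ih Qp p≢0̂ r ρp≡1+r i with i ℕₚ.≤? ⌊ r /2⌋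
    ... | no i≰r/2 = trans
      (coeff-gFrom-> r f (ℕₚ.≰⇒> i≰r/2))
      (sym (a-degree p Qp p≢0̂ i (subst (ℕ._≤ i ℕ.+ i) (sym ρp≡1+r) (above-half r (ℕₚ.≰⇒> i≰r/2)))))
      where
      f = fFrom (suc r) p (λ {q} _ → g[0̂, q ⟩)
      above-half : ∀ r {i} → ⌊ r /2⌋ <ℕ i → r <ℕ i ℕ.+ i
      above-half zero          {suc i} _             = ℕ.s≤s ℕ.z≤n
      above-half (suc zero)    {suc i} _             = ℕ.s≤s (ℕₚ.≤-trans (ℕ.s≤s ℕ.z≤n) (ℕₚ.m≤n+m (suc i) i))
      above-half (suc (suc r)) {suc i} (ℕ.s≤s r/2<i) =
        ℕ.s≤s (subst (suc (suc r) ℕ.≤_) (sym (ℕₚ.+-suc i i)) (ℕ.s≤s (above-half r r/2<i)))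
    ... | yes i≤r/2 = begin
      coeff (gFrom (suc r) f) i
        ≡⟨ coeff-gFrom-≤ r f i≤r/2 ⟩
      - (δ coeff f) i
        ≡⟨ cong -_ (δ-linear .≗-cong f≗Φ i) ⟩
      - (δ Φ) i
        ≡⟨ solveFor ((δ Φ) i) (a p i) (trans (sym δΦ+a≗rev) rev≡0) ⟩
      a p i ∎
      where
      f = fFrom (suc r) p (λ {q} _ → g[0̂, q ⟩)
      Φ : Series
      Φ i = sum (λ q → 𝟙 (q ⊏? p) * (δ^ (r ∸ ρ q) · a q) i)
      f≗Φ : coeff f ≗ Φ
      f≗Φ i = trans (coeff-fFrom r p i) (sum-cong-≗ λ q → 𝟙*-cong (q ⊏? p) λ q⊏p →
        fold-linear δ-linear (r ∸ ρ q) .≗-cong (ih q⊏p (Q-down (proj₁ q⊏p) Qp)) i)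
      δΦ+a≗rev : rev (ρ p) (a p) i ≡ (δ Φ) i + a p i
      δΦ+a≗rev = begin
        rev (ρ p) (a p) i
          ≡⟨ a-rev p Qp p≢0̂ i ⟨
        sum (λ q → 𝟙 (q ⊑? p) * (δ^ (ρ p ∸ ρ q) · a q) i)
          ≡⟨ sum-⊑-top p (λ q → (δ^ (ρ p ∸ ρ q) · a q) i) ⟩
        sum (λ q → 𝟙 (q ⊏? p) * (δ^ (ρ p ∸ ρ q) · a q) i) + (δ^ (ρ p ∸ ρ p) · a p) i
          ≡⟨ cong₂ _+_
               (sum-cong-≗ λ q → 𝟙*-cong (q ⊏? p) λ q⊏p → cong (λ m → (δ^ m · a q) i) (trans
                 (cong (_∸ ρ q) ρp≡1+r)
                 (ℕₚ.+-∸-assoc 1 (ℕₚ.≤-pred (subst (ρ q <ℕ_) ρp≡1+r (ρ-mono-⊏ q⊏p))))))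
               (cong (λ m → (δ^ m · a p) i) (ℕₚ.n∸n≡0 (ρ p))) ⟩
        sum (λ q → 𝟙 (q ⊏? p) * (δ δ^ (r ∸ ρ q) · a q) i) + a p i
          ≡⟨ cong (_+ a p i) (trans
               (sum-homo δ-linear (λ q i → 𝟙 (q ⊏? p) * (δ^ (r ∸ ρ q) · a q) i) i)
               (sum-cong-≗ λ q → δ-linear .*-homo (𝟙 (q ⊏? p)) (δ^ (r ∸ ρ q) · a q) i)) ⟨
        (δ Φ) i + a p i ∎
      2i≤r : i ℕ.+ i ℕ.≤ r
      2i≤r = subst (i ℕ.+ i ℕ.≤_) (ℕₚ.⌊n/2⌋+⌈n/2⌉≡n r)
        (ℕₚ.+-mono-≤ i≤r/2 (ℕₚ.≤-trans i≤r/2 (ℕₚ.⌊n/2⌋≤⌈n/2⌉ r)))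
      2i≤ρp : i ℕ.+ i ℕ.≤ ρ p
      2i≤ρp = subst (i ℕ.+ i ℕ.≤_) (sym ρp≡1+r) (ℕₚ.m≤n⇒m≤1+n 2i≤r)
      i≤ρp : i ℕ.≤ ρ p
      i≤ρp = ℕₚ.≤-trans (ℕₚ.m≤m+n i i) 2i≤ρp
      rev≡0 : rev (ρ p) (a p) i ≡ 0ℤ
      rev≡0 = trans (rev-≤ (a p) i≤ρp) (a-degree p Qp p≢0̂ (ρ p ∸ i)
        (subst (ℕ._≤ (ρ p ∸ i) ℕ.+ (ρ p ∸ i)) (ℕₚ.m∸n+n≡m i≤ρp)
          (ℕₚ.+-monoʳ-≤ (ρ p ∸ i) (ℕₚ.m+n≤o⇒m≤o∸n i 2i≤ρp))))
      solveFor : ∀ x y → x + y ≡ 0ℤ → - x ≡ y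
      solveFor x y eq = trans (isolate x y) (trans (cong (λ e → y - e) eq) (ℤₚ.+-identityʳ y))
        where
        isolate : ∀ x y → - x ≡ y - (x + y)
        isolate = solve-∀

-- Toric polynomials of P and of its dual

module DualSimplicialToric (P : GradedPoset) (eulerian : IsEulerian P) (dualSimplicial : IsDualSimplicial P) where
  open GradedPoset P
  open HalfOpen P
  open DualSimplicial eulerian dualSimplicial
  open Toric P
  open ToricCoefficients P

  -- The a(p) of the overview. `∑B 0̂` is an empty sum, so the value 1 at 0̂ has to be set
  -- separately.
  gSeries : Fin size → Series
  gSeries p = if does (p ≟ 0̂) then one else ∑B p

  gSeries-0̂ : gSeries 0̂ ≗ one
  gSeries-0̂ i with 0̂ ≟ 0̂
  ... | yes _  = refl
  ... | no 0̂≢0̂ = contradiction refl 0̂≢0̂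

  gSeries-≢0̂ : ∀ {p} → p ≢ 0̂ → gSeries p ≗ ∑B p
  gSeries-≢0̂ {p} p≢0̂ i with p ≟ 0̂
  ... | yes p≡0̂ = contradiction p≡0̂ p≢0̂
  ... | no _    = refl

  gSeries-rev : ∀ p → p ≢ 0̂ → ∀ i →
    sum (λ q → 𝟙 (q ⊑? p) * (δ^ (ρ p ∸ ρ q) · gSeries q) i) ≡ rev (ρ p) (gSeries p) i
  gSeries-rev p p≢0̂ i = begin
    sum (λ q → 𝟙 (q ⊑? p) * (δ^ (ρ p ∸ ρ q) · gSeries q) i)
      ≡⟨ sum-⊑ p (λ q → (δ^ (ρ p ∸ ρ q) · gSeries q) i) ⟩
    (δ^ (ρ p ∸ ρ 0̂) · gSeries 0̂) i + ∑₊ p (λ q → (δ^ (ρ p ∸ ρ q) · gSeries q) i)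
      ≡⟨ cong₂ _+_
           (trans (cong (λ r → (δ^ (ρ p ∸ r) · gSeries 0̂) i) ρ-0̂)
                  (fold-linear δ-linear (ρ p) .≗-cong gSeries-0̂ i))
           (∑₊-cong p λ q q≢0̂ _ → fold-linear δ-linear (ρ p ∸ ρ q) .≗-cong (gSeries-≢0̂ q≢0̂) i) ⟩
    c (ρ p) i + ∑₊ p (λ q → (δ^ (ρ p ∸ ρ q) · ∑B q) i)
      ≡⟨ rev-∑B p p≢0̂ i ⟩
    rev (ρ p) (∑B p) i
      ≡⟨ rev-linear (ρ p) .≗-cong (gSeries-≢0̂ p≢0̂) i ⟨
    rev (ρ p) (gSeries p) i ∎

  coeff-g : ∀ p → coeff g[0̂, p ⟩ ≗ gSeries p
  coeff-g p = g-unique (λ _ → ⊤) (λ _ _ → tt) gSeries gSeries-0̂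
    (λ p _ p≢0̂ i ρp≤2i → trans (gSeries-≢0̂ p≢0̂ i) (∑B-truncated p i ρp≤2i))
    (λ p _ → gSeries-rev p) p tt

  -- The closed version of f includes the summand p = 1̂, which makes it the left-hand side of the
  -- reciprocity at 1̂.
  coeff-f[0̂,1̂]-rev : 1̂ ≢ 0̂ → coeff f[0̂,1̂] ≗ rev rank (∑B 1̂)
  coeff-f[0̂,1̂]-rev 1̂≢0̂ i = begin
    coeff f[0̂,1̂] i
      ≡⟨ coeff-f[0̂,1̂] i ⟩
    sum (λ p → (δ^ (rank ∸ ρ p) · coeff g[0̂, p ⟩) i)
      ≡⟨ sum-cong-≗ (λ p → trans
           (fold-linear δ-linear (rank ∸ ρ p) .≗-cong (coeff-g p) i)
           (trans (sym (ℤₚ.*-identityˡ ((δ^ (rank ∸ ρ p) · gSeries p) i)))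
                  (cong (λ e → e * (δ^ (rank ∸ ρ p) · gSeries p) i) (sym (𝟙-yes (p ⊑? 1̂) (1̂-maximum p)))))) ⟩
    sum (λ p → 𝟙 (p ⊑? 1̂) * (δ^ (rank ∸ ρ p) · gSeries p) i)
      ≡⟨ gSeries-rev 1̂ 1̂≢0̂ i ⟩
    rev rank (gSeries 1̂) i
      ≡⟨ rev-linear rank .≗-cong (gSeries-≢0̂ 1̂≢0̂) i ⟩
    rev rank (∑B 1̂) i ∎

  private module Dual = Toric (P *)

  -- Lower intervals of the dual are the reversed [t, 1̂], Boolean for t ≠ 0̂. Reciprocity for the
  -- constant 1 says that (x - 1)^{ρ(r) - ρ(t)} sums to x^{rank - ρ(t)} over them. The predicate
  -- passed to `g-unique` leaves out the maximum 0̂ of the dual.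
  coeff-g-dual : ∀ t → t ≢ 0̂ → coeff Dual.g[0̂, t ⟩ ≗ one
  coeff-g-dual = ToricCoefficients.g-unique (P *) (_≢ 0̂) up-closed (λ _ → one) (λ _ → refl) degree boolean
    where
    open IsPartialOrder isPartialOrder using () renaming (antisym to ⊑-antisym)
    up-closed : ∀ {q p} → p ⊑ q → p ≢ 0̂ → q ≢ 0̂
    up-closed p⊑q p≢0̂ refl = p≢0̂ (⊑-antisym p⊑q (0̂-minimum _))
    degree : ∀ t → t ≢ 0̂ → t ≢ 1̂ → ∀ i → rank ∸ ρ t ℕ.≤ i ℕ.+ i → one i ≡ 0ℤ
    degree t _ t≢1̂ zero    le = contradiction
      (ℕₚ.m∸n≡0⇒m≤n (ℕₚ.n≤0⇒n≡0 le)) (ℕₚ.<⇒≱ (ρ-mono-⊏ (1̂-maximum t , t≢1̂)))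
    degree t _ _   (suc i) _  = refl
    rev-one : ∀ N → rev N one ≗ x^ N · one
    rev-one N i = begin
      rev N one i              ≡⟨ cong (λ N → rev N one i) (ℕₚ.+-identityʳ N) ⟨
      rev (N ℕ.+ 0) one i      ≡⟨ rev-+ N (c-degree 0) i ⟩
      (x^ N · rev 0 one) i     ≡⟨ fold-linear x·-linear N .≗-cong (λ { zero → refl ; (suc i) → refl }) i ⟩
      (x^ N · one) i           ∎
    boolean : ∀ t → t ≢ 0̂ → t ≢ 1̂ → ∀ i →
      sum (λ r → 𝟙 (t ⊑? r) * (δ^ ((rank ∸ ρ t) ∸ (rank ∸ ρ r)) · one) i) ≡ rev (rank ∸ ρ t) one i
    boolean t t≢0̂ _ i = begin
      sum (λ r → 𝟙 (t ⊑? r) * (δ^ ((rank ∸ ρ t) ∸ (rank ∸ ρ r)) · one) i)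
        ≡⟨ sum-cong-≗ (λ r → cong (𝟙 (t ⊑? r) *_) (trans
             (cong (λ m → (δ^ m · one) i) (∸-∸-cancel {ρ t} (ρ≤rank r)))
             (trans (sym (ℤₚ.*-identityˡ ((δ^ (ρ r ∸ ρ t) · one) i)))
                    (cong (λ e → e * (δ^ (ρ r ∸ ρ t) · one) i) (sym (𝟙-yes (r ⊑? 1̂) (1̂-maximum r))))))) ⟩
      sum (λ r → 𝟙 (t ⊑? r) * (𝟙 (r ⊑? 1̂) * (δ^ (ρ r ∸ ρ t) · one) i))
        ≡⟨ BooleanInterval.sum-interval P (dualSimplicial t t≢0̂) (1̂-maximum t) (λ m → (δ^ (m ∸ ρ t) · one) i) ⟩
      Cube (rank ∸ ρ t) (λ s → (δ^ (ρ t ℕ.+ s ∸ ρ t) · one) i)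
        ≡⟨ Cube-cong (rank ∸ ρ t) (λ s _ → cong (λ m → (δ^ m · one) i) (ℕₚ.m+n∸m≡n (ρ t) s)) ⟩
      Cube (rank ∸ ρ t) (λ s → (δ^ s · one) i)
        ≡⟨ Cube-δ (rank ∸ ρ t) one i ⟩
      (x^ (rank ∸ ρ t) · one) i
        ≡⟨ rev-one (rank ∸ ρ t) i ⟨
      rev (rank ∸ ρ t) one i ∎
      where
      ∸-∸-cancel : ∀ {m n o} → n ℕ.≤ o → (o ∸ m) ∸ (o ∸ n) ≡ n ∸ m
      ∸-∸-cancel {m} {n} {o} n≤o = begin
        (o ∸ m) ∸ (o ∸ n)   ≡⟨ ℕₚ.∸-+-assoc o m (o ∸ n) ⟩
        o ∸ (m ℕ.+ (o ∸ n)) ≡⟨ cong (o ∸_) (ℕₚ.+-comm m (o ∸ n)) ⟩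
        o ∸ (o ∸ n ℕ.+ m)   ≡⟨ ℕₚ.∸-+-assoc o (o ∸ n) m ⟨
        o ∸ (o ∸ n) ∸ m     ≡⟨ cong (_∸ m) (ℕₚ.m∸[m∸n]≡n n≤o) ⟩
        n ∸ m               ∎

  module _ {n} (rank≡1+n : rank ≡ suc n) where

    1̂≢0̂ : 1̂ ≢ 0̂
    1̂≢0̂ 1̂≡0̂ with () ← trans (sym rank≡1+n) (trans (cong ρ 1̂≡0̂) ρ-0̂)

    -- The h(1̂) of the overview. As ρ(q) > 0 for q ≠ 0̂, `pred` is a genuine subtraction.
    h : Series
    h i = ∑₊ 1̂ (λ q → c (ℕ.pred (ρ q)) i)

    δh : δ h ≗ D 1̂
    δh i = trans
      (∑₊-linear δ-linear 1̂ (λ q → c (ℕ.pred (ρ q))) i)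
      (∑₊-cong 1̂ λ q q≢0̂ _ → cong (λ k → c k i)
        (ℕₚ.suc-pred (ρ q) {{ℕ.>-nonZero (subst (_<ℕ ρ q) ρ-0̂ (ρ-mono-⊏ (0̂-minimum q , q≢0̂ ∘ sym)))}}))

    coeff-f-dual : coeff Dual.f[0̂, 0̂ ⟩ ≗ h
    coeff-f-dual i = begin
      coeff Dual.f[0̂, 0̂ ⟩ i
        ≡⟨ cong (λ r → coeff (Dual.fFrom r 0̂ (λ {q} _ → Dual.g[0̂, q ⟩)) i) (trans (cong (rank ∸_) ρ-0̂) rank≡1+n) ⟩
      coeff (Dual.fFrom (suc n) 0̂ (λ {q} _ → Dual.g[0̂, q ⟩)) i
        ≡⟨ ToricCoefficients.coeff-fFrom (P *) n 0̂ i ⟩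
      sum (λ q → 𝟙 (GradedPoset._⊏?_ (P *) q 0̂) * (δ^ (n ∸ (rank ∸ ρ q)) · coeff Dual.g[0̂, q ⟩) i)
        ≡⟨ sum-cong-≗ (λ q → cong (λ e → e * (δ^ (n ∸ (rank ∸ ρ q)) · coeff Dual.g[0̂, q ⟩) i)
             (𝟙-cong (GradedPoset._⊏?_ (P *) q 0̂) (q ∈⟨0̂, 1̂ ]?)
               (λ (_ , q≢0̂) → q≢0̂ , 1̂-maximum q) (λ (q≢0̂ , _) → 0̂-minimum q , q≢0̂))) ⟩
      ∑₊ 1̂ (λ q → (δ^ (n ∸ (rank ∸ ρ q)) · coeff Dual.g[0̂, q ⟩) i)
        ≡⟨ ∑₊-cong 1̂ (λ q q≢0̂ _ → trans
             (fold-linear δ-linear (n ∸ (rank ∸ ρ q)) .≗-cong (coeff-g-dual q q≢0̂) i)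
             (cong (λ k → c k i) (corank q))) ⟩
      h i ∎
      where
      corank : ∀ q → n ∸ (rank ∸ ρ q) ≡ ℕ.pred (ρ q)
      corank q = begin
        n ∸ (rank ∸ ρ q)           ≡⟨ cong (λ r → ℕ.pred r ∸ (rank ∸ ρ q)) rank≡1+n ⟨
        rank ∸ 1 ∸ (rank ∸ ρ q)    ≡⟨ ℕₚ.∸-+-assoc rank 1 (rank ∸ ρ q) ⟩
        rank ∸ (1 ℕ.+ (rank ∸ ρ q)) ≡⟨ cong (rank ∸_) (ℕₚ.+-comm 1 (rank ∸ ρ q)) ⟩
        rank ∸ (rank ∸ ρ q ℕ.+ 1)  ≡⟨ ℕₚ.∸-+-assoc rank (rank ∸ ρ q) 1 ⟨
        rank ∸ (rank ∸ ρ q) ∸ 1    ≡⟨ cong (_∸ 1) (ℕₚ.m∸[m∸n]≡n (ρ≤rank q)) ⟩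
        ℕ.pred (ρ q)               ∎

    toric-h-dual : ∀ {i} → i ℕ.≤ n → Dual.toric-h i ≡ h (n ∸ i)
    toric-h-dual {i} i≤n = begin
      Dual.toric-h i
        ≡⟨ cong (λ r → coeff (reciprocal (ℕ.pred r) Dual.f[0̂, 0̂ ⟩) i) (trans (cong (rank ∸_) ρ-0̂) rank≡1+n) ⟩
      coeff (reciprocal n Dual.f[0̂, 0̂ ⟩) i
        ≡⟨ coeff-applyUpTo-< (λ i → coeff Dual.f[0̂, 0̂ ⟩ (n ∸ i)) (ℕ.s≤s i≤n) ⟩
      coeff Dual.f[0̂, 0̂ ⟩ (n ∸ i)
        ≡⟨ coeff-f-dual (n ∸ i) ⟩
      h (n ∸ i) ∎

    -- At index 0 the value is -1 by the Euler relation. Otherwise, as `toric-h` lists the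
    -- coefficients of h backwards, the hypothesis says that D is nonnegative at the mirror index
    -- `suc k`, and antisymmetry carries this to `suc i` with the opposite sign.
    D≤0 : (∀ i → i <ℕ ⌊ n /2⌋ → Dual.toric-h i ≤ Dual.toric-h (suc i)) →
      ∀ i k → i ℕ.+ k ≡ rank → i <ℕ k → D 1̂ i ≤ 0ℤ
    D≤0 mono zero    k _        _   = subst (_≤ 0ℤ) (sym (D-zero 1̂ 1̂≢0̂)) ℤ.-≤+
    D≤0 mono (suc i) zero    _ ()
    D≤0 mono (suc i) (suc k) 1+i+1+k≡rank 1+i<1+k =
      subst (_≤ 0ℤ) (sym (D-antisymmetric 1̂ (suc k) (suc i) (trans (ℕₚ.+-comm (suc k) (suc i)) 1+i+1+k≡rank)))
        (ℤₚ.neg-mono-≤ (subst (0ℤ ≤_) (δh (suc k)) (ℤₚ.i≤j⇒0≤j-i (subst₂ _≤_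
          (trans (toric-h-dual (ℕₚ.<⇒≤ i<n)) (cong h n∸i≡1+k))
          (trans (toric-h-dual i<n) (cong h (trans (sym (ℕₚ.pred[m∸n]≡m∸[1+n] n i)) (cong ℕ.pred n∸i≡1+k))))
          (mono i i<n/2)))))
      where
      i+1+k≡n : i ℕ.+ suc k ≡ n
      i+1+k≡n = ℕₚ.suc-injective (trans 1+i+1+k≡rank rank≡1+n)
      n∸i≡1+k : n ∸ i ≡ suc k
      n∸i≡1+k = trans (cong (_∸ i) (sym i+1+k≡n)) (ℕₚ.m+n∸m≡n i (suc k))
      i<n : i <ℕ n
      i<n = subst (i <ℕ_) i+1+k≡n (ℕₚ.m<m+n i (ℕ.s≤s ℕ.z≤n))
      -- From i < k and i + (k + 1) = n follows 2(i + 1) ≤ n, so i lies in the range of the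
      -- hypothesis.
      i<n/2 : i <ℕ ⌊ n /2⌋
      i<n/2 = subst (ℕ._≤ ⌊ n /2⌋) (sym (ℕₚ.n≡⌊n+n/2⌋ (suc i)))
        (ℕₚ.⌊n/2⌋-mono (subst (suc i ℕ.+ suc i ℕ.≤_) (trans (sym (ℕₚ.+-suc i k)) i+1+k≡n)
          (ℕ.s≤s (ℕₚ.+-monoʳ-≤ i (ℕₚ.≤-pred 1+i<1+k)))))

    f[0̂,1̂]-nonNegative :
      (∀ i → i <ℕ ⌊ n /2⌋ → Dual.toric-h i ≤ Dual.toric-h (suc i)) → NonNegative f[0̂,1̂]
    f[0̂,1̂]-nonNegative mono i = subst (0ℤ ≤_) (sym (coeff-f[0̂,1̂]-rev 1̂≢0̂ i))
      (rev-nonneg rank (λ j → subst (0ℤ ≤_) (sym (∑B-antidiagonal 1̂ j))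
        (antidiagonal-antisymmetric-nonneg rank j (D 1̂) (D-antisymmetric 1̂) (D≤0 mono))) i)

corollary6p10 : (n : ℕ) (P : GradedPoset) →
    GradedPoset.rank P ≡ suc n →
    IsEulerian P →
    IsDualSimplicial P →
    (∀ i → i <ℕ ⌊ n /2⌋ → Toric.toric-h (P *) i ≤ Toric.toric-h (P *) (suc i)) →
    NonNegative (Toric.f[0̂,1̂] P)
corollary6p10 n P rank≡1+n eulerian dualSimplicial =
  DualSimplicialToric.f[0̂,1̂]-nonNegative P eulerian dualSimplicial rank≡1+n
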